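{- Let $G$ be an $8$-connected graph and let $u_1,u_2,u_3,u_4$ be four distinct vertices of $G$ such that $G$ contains no kite-linkage of $(u_2,u_1,u_3,u_4)$. Then $G$ contains a $(u_1,u_2,u_3,u_4)$-flower or a $(u_3,u_2,u_1,u_4)$-flower.
   Context: A kite-linkage of $(u_2,u_1,u_3,u_4)$ in $G$ is a collection of four internally disjoint paths in $G$: a $u_2,u_1$-path, a $u_1,u_3$-path, a $u_3,u_2$-path and a $u_2,u_4$-path. For distinct vertices $u_1,u_2,u_3,u_4$, a $(u_1,u_2,u_3,u_4)$-flower is a tuple $(C_1,C_2,C_3,P_1,P_2,P_3)$ such that: (i) $C_1,C_2,C_3$ are cycles of $G$ with $u_1\in V(C_1)$, $u_3\in V(C_2)$, $V(C_1)\cap V(C_2)=\{u_2\}$, and $C_3$ is vertex-disjoint from $C_1$ and $C_2$; (ii) for each $i\in\{1,2,3\}$, $P_i$ is a path from $u_i$ to some vertex $v_i\in V(C_3)$ that is internally disjoint from $V(C_1)\cup V(C_2)\cup V(C_3)$; (iii) $P_1,P_2,P_3$ are pairwise vertex-disjoint, and $v_1,v_2,v_3,u_4$ occur on $C_3$ in this cyclic order. -}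

module Defs where

open import Data.Nat using (ℕ; _≤_; _<_)
open import Data.Fin using (Fin)
open import Data.List using (List; []; _∷_; _++_; length; reverse)
open import Data.List.Membership.Propositional using (_∈_; _∉_)
open import Data.List.Relation.Unary.Unique.Propositional using (Unique)
open import Data.List.Relation.Unary.All using (All)
open import Data.List.Relation.Binary.Sublist.Propositional using (_⊆_)
open import Data.Product using (Σ; _×_; ∃; ∃-syntax)
open import Data.Sum using (_⊎_)
open import Relation.Nullary using (¬_)
open import Relation.Binary.PropositionalEquality using (_≡_)

record SimpleGraph (n : ℕ) : Set₁ where
  field
    Adj    : Fin n → Fin n → Set
    sym    : ∀ {x y} → Adj x y → Adj y x
    irrefl : ∀ {x} → ¬ Adj x x
open SimpleGraph public

module _ {n : ℕ} (G : SimpleGraph n) where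

  data Walk : Fin n → Fin n → List (Fin n) → Set where
    single : ∀ a → Walk a a (a ∷ [])
    step   : ∀ {a b c xs} → Adj G a b → Walk b c xs → Walk a c (a ∷ xs)

  IsPath : Fin n → Fin n → List (Fin n) → Set
  IsPath a b xs = Walk a b xs × Unique xs

  IsCycle : List (Fin n) → Set
  IsCycle cs = Σ (Fin n) λ c₀ → Σ (Fin n) λ cₗ →
    Walk c₀ cₗ cs × Adj G cₗ c₀ × Unique cs × 3 ≤ length cs

dropLast : {A : Set} → List A → List A
dropLast []             = []
dropLast (x ∷ [])       = []
dropLast (x ∷ y ∷ ys)   = x ∷ dropLast (y ∷ ys)

inner : {A : Set} → List A → List A
inner []       = []
inner (x ∷ xs) = dropLast xs

Disjoint : {A : Set} → List A → List A → Set
Disjoint xs ys = ∀ {v} → v ∈ xs → v ∉ ys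

InternallyDisjoint : {A : Set} → List A → List A → Set
InternallyDisjoint P Q = Disjoint P (inner Q) × Disjoint Q (inner P)

CyclicOrder : {A : Set} → List A → A → A → A → A → Set
CyclicOrder cs a b c d = ∃[ xs ] ∃[ ys ] (cs ≡ xs ++ ys ×
  ((a ∷ b ∷ c ∷ d ∷ []) ⊆ (ys ++ xs) ⊎ (a ∷ b ∷ c ∷ d ∷ []) ⊆ reverse (ys ++ xs)))

module _ {n : ℕ} (G : SimpleGraph n) where

  Connected-without : List (Fin n) → Set
  Connected-without S = ∀ a b → a ∉ S → b ∉ S →
    ∃[ xs ] (IsPath G a b xs × Disjoint xs S)

  KConnected : ℕ → Set
  KConnected k = k < n × (∀ (S : List (Fin n)) → length S < k → Connected-without S)

  KiteLinkage : Fin n → Fin n → Fin n → Fin n → Set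
  KiteLinkage u₂ u₁ u₃ u₄ = ∃[ P ] ∃[ Q ] ∃[ R ] ∃[ S ]
    (IsPath G u₂ u₁ P × IsPath G u₁ u₃ Q × IsPath G u₃ u₂ R × IsPath G u₂ u₄ S ×
     InternallyDisjoint P Q × InternallyDisjoint P R × InternallyDisjoint P S ×
     InternallyDisjoint Q R × InternallyDisjoint Q S × InternallyDisjoint R S)

  Flower : Fin n → Fin n → Fin n → Fin n → Set
  Flower u₁ u₂ u₃ u₄ = ∃[ C₁ ] ∃[ C₂ ] ∃[ C₃ ] ∃[ P₁ ] ∃[ P₂ ] ∃[ P₃ ]
    ∃[ v₁ ] ∃[ v₂ ] ∃[ v₃ ]
    (IsCycle G C₁ × IsCycle G C₂ × IsCycle G C₃ ×
     u₁ ∈ C₁ × u₃ ∈ C₂ ×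
     u₂ ∈ C₁ × u₂ ∈ C₂ × (∀ {v} → v ∈ C₁ → v ∈ C₂ → v ≡ u₂) ×
     Disjoint C₃ C₁ × Disjoint C₃ C₂ ×
     IsPath G u₁ v₁ P₁ × IsPath G u₂ v₂ P₂ × IsPath G u₃ v₃ P₃ ×
     v₁ ∈ C₃ × v₂ ∈ C₃ × v₃ ∈ C₃ ×
     Disjoint (inner P₁) (C₁ ++ C₂ ++ C₃) ×
     Disjoint (inner P₂) (C₁ ++ C₂ ++ C₃) ×
     Disjoint (inner P₃) (C₁ ++ C₂ ++ C₃) ×
     Disjoint P₁ P₂ × Disjoint P₁ P₃ × Disjoint P₂ P₃ ×
     CyclicOrder C₃ v₁ v₂ v₃ u₄)

{-# OPTIONS --safe #-}
-- Take two disjoint walks from u₂ to u₁ and two from u₂ to u₃ (the arms, forming C₁ ∪ C₂) and a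
-- connected set M off the arms and off u₁, …, u₄ that is adjacent to u₄, with M as large as possible.
-- If u₂ had no neighbour in M, Menger's theorem would give arms together with a further walk from
-- u₂ to a neighbour of M, and M could be enlarged.  Hence u₂ and u₄ are joined through M, so, as there
-- is no kite, the loops C₁ and C₂ lie in different components outside M ∪ {u₂}; the same enlargement
-- argument within one component shows that u₁ and u₃ have neighbours in M as well.  Now every
-- neighbour of u₄ outside M other than u₁, u₃ yields a kite, so M ∪ {u₄} contains a cycle C₃
-- through u₄.  Menger's theorem inside M gives disjoint paths from C₃ to C₁ ∖ u₂, to u₂ and to C₂ ∖ u₂;
-- a path from u₁ through M to this configuration either moves the first of them to u₁ or creates a
-- kite, and likewise for u₃.  Any cyclic order on C₃ other than the required one gives a kite.
module Submission where

open import Defs renaming (sym to Adj-sym)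
open import Data.Nat using (ℕ)
open import Data.Fin using (Fin)
open import Data.Sum using (_⊎_)
open import Relation.Nullary using (¬_)
open import Relation.Binary.PropositionalEquality using (_≢_)

open import Data.Bool using (Bool; true; false; not)
open import Data.Empty using (⊥; ⊥-elim)
open import Data.Fin using (zero; suc; inject₁; inject≤)
open import Data.Fin.Patterns using (0F; 1F; 2F; 3F; 4F)
import Data.Fin.Properties as Fₚ
open import Data.List using (List; []; _∷_; _++_; length; map; filter; deduplicate; allFin; reverse; lookup; concatMap; cartesianProduct)
open import Data.List.Membership.Propositional using (_∈_; _∉_)
open import Data.List.Membership.Propositional.Properties using (∈-++⁺ˡ; ∈-++⁺ʳ; ∈-++⁻; ∈-∃++; ∈-lookup; ∈-allFin; ∈-map⁺; ∈-map⁻; ∈-filter⁺; ∈-filter⁻; ∈-deduplicate⁺; ∈-deduplicate⁻; ∈-concatMap⁺; ∈-cartesianProduct⁺)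
import Data.List.Membership.DecPropositional as DecMem
import Data.List.Properties as Lₚ
open import Data.List.Relation.Binary.Sublist.Propositional using (_⊆_; _∷_) renaming (from∈ to singleton⊆)
import Data.List.Relation.Binary.Sublist.Propositional.Properties as Subₚ
open import Data.List.Relation.Unary.All as All using ([]; _∷_)
open import Data.List.Relation.Unary.AllPairs using ([]; _∷_)
open import Data.List.Relation.Unary.Any as Any using (here; there; index)
open import Data.List.Relation.Unary.Any.Properties using (lookup-index) renaming (reverse⁻ to ∈-reverse⁻)
open import Data.List.Relation.Unary.Unique.DecPropositional.Properties using (deduplicate-!)
open import Data.List.Relation.Unary.Unique.Propositional using (Unique)
import Data.List.Relation.Unary.Unique.Propositional.Properties as Uₚ
open import Data.Nat using (zero; suc; _+_; _≤_; _<_; z≤n; s≤s)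
import Data.Nat.Properties as ℕₚ
open import Data.Product using (Σ; _×_; _,_; proj₁; proj₂; ∃-syntax)
open import Data.Product.Properties using () renaming (≡-dec to ×-≡-dec)
open import Data.Sum using (inj₁; inj₂; [_,_]′; swap)
import Data.Sum.Properties as ⊎ₚ
open import Data.Unit using (⊤; tt)
open import Function using (_∘_; id)
open import Relation.Binary using (DecidableEquality)
open import Relation.Binary.PropositionalEquality using (_≡_; refl; sym; trans; cong; subst)
open import Relation.Nullary using (Dec; yes; no; ¬?)
open import Relation.Nullary.Decidable using (_×-dec_; _⊎-dec_; decidable-stable)
open import Relation.Unary using (Decidable)

-- The 8 is the price of three steps that each delete up to seven vertices: the first arms (a
-- neighbour of `u₄`, three roots, a cut of at most three), the contact of `u₂` with `M` (three
-- roots, a cut of at most four) and the cut vertex (that vertex, all four roots, a cut of at most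
-- two). The uses of Menger's theorem with a spare path share one pattern. A full set of paths
-- enlarges `M` or yields a kite. Otherwise there is a cut, and the walks already at hand exhaust
-- it, so that the gates of the spare path stay open and 8-connectivity finds a way around the cut.
-- The obstacle is constructive: maximality of `M`, components and Menger's theorem need decidable
-- adjacency, which `Adj` does not offer, so the argument runs in a finite subgraph with decidable
-- adjacency. Kites are described by disjoint regions rather than by paths, which reduces
-- disjointness to predicates and postpones simplicity of paths to the very end.

-- Counting with injections into lists

injection-length : ∀ {V : Set} {m} (f : Fin m → V) (T : List V) →
  (∀ {i j} → f i ≡ f j → i ≡ j) → (∀ i → f i ∈ T) → m ≤ length T
injection-length f T inj f∈ = Fₚ.injective⇒≤ {f = λ i → index (f∈ i)} λ {i} {j} eq →
  inj (trans (lookup-index (f∈ i)) (trans (cong (lookup T) eq) (sym (lookup-index (f∈ j)))))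

suc-injection : ∀ {V : Set} {m} (f : Fin m → V) (v : V) → (∀ {i j} → f i ≡ f j → i ≡ j) →
  (∀ i → f i ≢ v) → (T : List V) → (∀ i → f i ∈ T) → v ∈ T → suc m ≤ length T
suc-injection {V} {m} f v inj miss T f∈ v∈ = injection-length g T g-inj g∈
  where
  g : Fin (suc m) → V
  g zero    = v
  g (suc i) = f i
  g-inj : ∀ {i j} → g i ≡ g j → i ≡ j
  g-inj {zero}  {zero}  _  = refl
  g-inj {zero}  {suc j} eq = ⊥-elim (miss j (sym eq))
  g-inj {suc i} {zero}  eq = ⊥-elim (miss i eq)
  g-inj {suc i} {suc j} eq = cong suc (inj eq)
  g∈ : ∀ i → g i ∈ T
  g∈ zero    = v∈
  g∈ (suc i) = f∈ i

onto : ∀ {V : Set} → DecidableEquality V → ∀ {m} (f : Fin m → V) (T : List V) →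
  (∀ {i j} → f i ≡ f j → i ≡ j) → (∀ i → f i ∈ T) → length T ≤ m → ∀ {v} → v ∈ T → ∃[ i ] f i ≡ v
onto _≟_ f T inj f∈ le {v} v∈ with Fₚ.any? (λ i → f i ≟ v)
... | yes hit = hit
... | no miss = ⊥-elim (ℕₚ.<-irrefl refl
        (ℕₚ.≤-trans (suc-injection f v inj (λ i eq → miss (i , eq)) T f∈ v∈) le))

Unique-lookup : ∀ {V : Set} {xs : List V} → Unique xs → ∀ {i j} → lookup xs i ≡ lookup xs j → i ≡ j
Unique-lookup (_ ∷ _)  {zero}  {zero}  _  = refl
Unique-lookup (px ∷ _) {zero}  {suc j} eq = ⊥-elim (All.lookup px (∈-lookup j) eq)
Unique-lookup (px ∷ _) {suc i} {zero}  eq = ⊥-elim (All.lookup px (∈-lookup i) (sym eq))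
Unique-lookup (_ ∷ u)  {suc i} {suc j} eq = cong suc (Unique-lookup u eq)

-- Walks over a relation and ways to cut them

-- A `Walk` over an arbitrary relation, because the same operations serve the decidable adjacency
-- and the arcs of the auxiliary digraphs in Menger's theorem.
data Chain {V : Set} (R : V → V → Set) : V → V → List V → Set where
  stop : ∀ a → Chain R a a (a ∷ [])
  _∷_  : ∀ {a b c xs} → R a b → Chain R b c xs → Chain R a c (a ∷ xs)

module _ {V : Set} {R : V → V → Set} where

  recast : ∀ {a a′ b b′ xs} → a ≡ a′ → b ≡ b′ → Chain R a b xs → Chain R a′ b′ xs
  recast refl refl c = c

  head∈ : ∀ {a b xs} → Chain R a b xs → a ∈ xs
  head∈ (stop _) = here refl
  head∈ (_ ∷ _)  = here refl

  last∈ : ∀ {a b xs} → Chain R a b xs → b ∈ xs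
  last∈ (stop _) = here refl
  last∈ (_ ∷ c)  = there (last∈ c)

  nonempty : ∀ {a b xs} → Chain R a b xs → 1 ≤ length xs
  nonempty (stop _) = s≤s z≤n
  nonempty (_ ∷ _)  = s≤s z≤n

  append : ∀ {a b c d xs ys} → Chain R a b xs → R b c → Chain R c d ys → Chain R a d (xs ++ ys)
  append (stop _) e d = e ∷ d
  append (r ∷ c)  e d = r ∷ append c e d

  join : ∀ {a b c xs ys} → Chain R a b xs → Chain R b c ys →
    ∃[ zs ] (Chain R a c zs × ∀ {v} → v ∈ zs → v ∈ xs ⊎ v ∈ ys)
  join (stop _) d = _ , d , inj₂
  join (r ∷ c)  d with join c d
  ... | zs , e , sub = _ , r ∷ e , λ { (here refl) → inj₁ (here refl)
                                     ; (there m) → [ inj₁ ∘ there , inj₂ ]′ (sub m) }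

  prefix : ∀ {a b v xs} → Chain R a b xs → v ∈ xs → ∃[ ys ] (Chain R a v ys × ∀ {w} → w ∈ ys → w ∈ xs)
  prefix (stop a) (here refl) = _ , stop a , id
  prefix (r ∷ c) (here refl)  = _ , stop _ , λ { (here refl) → here refl }
  prefix (r ∷ c) (there m) with prefix c m
  ... | ys , d , sub = _ , r ∷ d , λ { (here refl) → here refl ; (there m′) → there (sub m′) }

  suffix : ∀ {a b v xs} → Chain R a b xs → v ∈ xs → ∃[ ys ] (Chain R v b ys × ∀ {w} → w ∈ ys → w ∈ xs)
  suffix (stop a) (here refl) = _ , stop a , id
  suffix (r ∷ c) (here refl)  = _ , r ∷ c , id
  suffix (r ∷ c) (there m) with suffix c m
  ... | ys , d , sub = _ , d , there ∘ sub

  reverse-chain : (∀ {x y} → R x y → R y x) → ∀ {a b xs} → Chain R a b xs → Chain R b a (reverse xs)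
  reverse-chain sy (stop a) = stop a
  reverse-chain sy {a} {b} (_∷_ {xs = xs} r c) =
    subst (Chain R b a) (sym (Lₚ.unfold-reverse a xs)) (append (reverse-chain sy c) (sy r) (stop a))

  shorten : DecidableEquality V → ∀ {a b xs} → Chain R a b xs →
    ∃[ ys ] (Chain R a b ys × Unique ys × ∀ {v} → v ∈ ys → v ∈ xs)
  shorten _≟_ (stop a) = _ , stop a , [] ∷ [] , id
  shorten _≟_ {a} (r ∷ c) with shorten _≟_ c
  ... | ys , d , u , sub with DecMem._∈?_ _≟_ a ys
  ...   | no a∉ = _ , r ∷ d , All.tabulate (λ { m refl → a∉ m }) ∷ u ,
                  λ { (here refl) → here refl ; (there m) → there (sub m) }
  ...   | yes a∈ = let zs , e , u′ , sub′ = suffix-unique d u a∈ in zs , e , u′ , there ∘ sub ∘ sub′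
    where
    suffix-unique : ∀ {a b v xs} → Chain R a b xs → Unique xs → v ∈ xs →
      ∃[ ys ] (Chain R v b ys × Unique ys × ∀ {w} → w ∈ ys → w ∈ xs)
    suffix-unique (stop a) u (here refl) = _ , stop a , u , id
    suffix-unique (r ∷ c) u (here refl)  = _ , r ∷ c , u , id
    suffix-unique (r ∷ c) (_ ∷ u) (there m) with suffix-unique c u m
    ... | ys , d , u′ , sub = _ , d , u′ , there ∘ sub

  module _ {P : V → Set} (P? : Decidable P) where

    -- Every vertex before the hit also receives its own walk from `a` avoiding `P`; the gluing in
    -- Menger's theorem splices such walks into one that misses the separator.
    first-hit : ∀ {a b xs} → Chain R a b xs → P b →
      ∃[ c ] ∃[ ys ] (Chain R a c ys × P c × (∀ {v} → v ∈ ys → v ∈ xs) ×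
        (∀ {v} → v ∈ ys → v ≡ c ⊎ (¬ P v × ∃[ zs ] (Chain R a v zs × ∀ {w} → w ∈ zs → ¬ P w))))
    first-hit (stop a) p = _ , _ , stop a , p , id , λ { (here refl) → inj₁ refl }
    first-hit {a} (r ∷ c) p with P? a
    ... | yes pa = _ , _ , stop a , pa , (λ { (here refl) → here refl }) , λ { (here refl) → inj₁ refl }
    ... | no ¬pa with first-hit c p
    ...   | c′ , ys , d , pc , sub , off = c′ , _ , r ∷ d , pc ,
            (λ { (here refl) → here refl ; (there m) → there (sub m) }) ,
            λ { (here refl) → inj₂ (¬pa , _ , stop a , λ { (here refl) → ¬pa })
              ; (there m) → [ inj₁ , (λ (¬pv , zs , e , av) →
                  inj₂ (¬pv , _ , r ∷ e , λ { (here refl) → ¬pa ; (there m′) → av m′ })) ]′ (off m) }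

    last-hit : ∀ {a b xs} → Chain R a b xs → (∀ {v} → v ∈ xs → ¬ P v) ⊎
      ∃[ c ] ∃[ ys ] (Chain R c b ys × P c × (∀ {v} → v ∈ ys → v ∈ xs) ×
        (∀ {v} → v ∈ ys → v ≡ c ⊎ (¬ P v × ∃[ zs ] (Chain R v b zs × ∀ {w} → w ∈ zs → ¬ P w))))
    last-hit (stop a) with P? a
    ... | yes pa = inj₂ (_ , _ , stop a , pa , id , λ { (here refl) → inj₁ refl })
    ... | no ¬pa = inj₁ λ { (here refl) → ¬pa }
    last-hit {a} (r ∷ c) with last-hit c
    ... | inj₂ (c′ , ys , d , pc , sub , off) = inj₂ (c′ , ys , d , pc , there ∘ sub , off)
    ... | inj₁ av with P? a
    ...   | no ¬pa = inj₁ λ { (here refl) → ¬pa ; (there m) → av m }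
    ...   | yes pa = inj₂ (a , _ , r ∷ c , pa , id , λ { (here refl) → inj₁ refl
              ; (there m) → let zs , d , sub = suffix c m in inj₂ (av m , zs , d , av ∘ sub) })

map-chain : ∀ {V : Set} {R Q : V → V → Set} → (∀ {x y} → R x y → Q x y) →
  ∀ {a b xs} → Chain R a b xs → Chain Q a b xs
map-chain f (stop a) = stop a
map-chain f (r ∷ c)  = f r ∷ map-chain f c

split-chain : ∀ {V : Set} {R : V → V → Set} {a b v} xs {ys} → Chain R a b (xs ++ v ∷ ys) →
  Chain R a v (xs ++ v ∷ []) × Chain R v b (v ∷ ys)
split-chain [] (stop _) = stop _ , stop _
split-chain [] (r ∷ c)  = stop _ , r ∷ c
split-chain (x ∷ []) (r ∷ c) = let p , q = split-chain [] c in r ∷ p , q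
split-chain (x ∷ y ∷ xs) (r ∷ c) = let p , q = split-chain (y ∷ xs) c in r ∷ p , q

unique-split : ∀ {V : Set} (xs : List V) {v ys} → Unique (xs ++ v ∷ ys) →
  v ∉ xs × v ∉ ys × (∀ {w} → w ∈ xs → w ∉ ys)
unique-split [] (p ∷ _) = (λ ()) , (λ m → All.lookup p m refl) , λ ()
unique-split (x ∷ xs) (p ∷ u) = let q , r , s = unique-split xs u in
  (λ { (here refl) → All.lookup p (∈-++⁺ʳ xs (here refl)) refl ; (there m) → q m }) , r ,
  (λ { (here refl) m → All.lookup p (∈-++⁺ʳ xs (there m)) refl ; (there m) → s m })

record SplitAt {V : Set} (R : V → V → Set) (a b t : V) (T : List V) : Set where
  field
    before after : List V
    split        : T ≡ before ++ t ∷ after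
    to-t         : Chain R a t (before ++ t ∷ [])
    from-t       : Chain R t b (t ∷ after)
    t∉before     : t ∉ before
    t∉after      : t ∉ after
    separated    : ∀ {w} → w ∈ before → w ∉ after

  before⊆ : ∀ {w} → w ∈ before → w ∈ T
  before⊆ m = subst (_ ∈_) (sym split) (∈-++⁺ˡ m)
  after⊆ : ∀ {w} → w ∈ after → w ∈ T
  after⊆ m = subst (_ ∈_) (sym split) (∈-++⁺ʳ before (there m))

split-at : ∀ {V : Set} {R : V → V → Set} {a b t T} → Chain R a b T → Unique T → t ∈ T → SplitAt R a b t T
split-at c u t∈ with ∈-∃++ t∈
... | L , _ , refl = let p , q = split-chain L c ; x , y , z = unique-split L u in record
  { before = L ; split = refl ; to-t = p ; from-t = q ; t∉before = x ; t∉after = y ; separated = z }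

three-≤ : ∀ {A : Set} {S : List A} {a b c} → a ∈ S → b ∈ S → c ∈ S → a ≢ b → a ≢ c → b ≢ c → 3 ≤ length S
three-≤ {A} {S} {a} {b} {c} a∈ b∈ c∈ ab ac bc = injection-length f S (λ {i} {j} → inj i j) f∈
  where
  f : Fin 3 → A
  f 0F = a
  f 1F = b
  f 2F = c
  f∈ : ∀ i → f i ∈ S
  f∈ 0F = a∈
  f∈ 1F = b∈
  f∈ 2F = c∈
  inj : ∀ i j → f i ≡ f j → i ≡ j
  inj 0F 0F _ = refl
  inj 0F 1F e = ⊥-elim (ab e)
  inj 0F 2F e = ⊥-elim (ac e)
  inj 1F 0F e = ⊥-elim (ab (sym e))
  inj 1F 1F _ = refl
  inj 1F 2F e = ⊥-elim (bc e)
  inj 2F 0F e = ⊥-elim (ac (sym e))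
  inj 2F 1F e = ⊥-elim (bc (sym e))
  inj 2F 2F _ = refl

-- `prefix` bounds the new walk by the whole list only; here it has to stay in the part `xs`. The
-- equation leaves the list index of the chain free for matching.
prefix-within : ∀ {V : Set} {R : V → V → Set} {a b xs ys zs w} → Chain R a b zs → zs ≡ xs ++ ys → w ∈ xs →
  ∃[ ws ] (Chain R a w ws × ∀ {v} → v ∈ ws → v ∈ xs)
prefix-within {xs = x ∷ xs} (stop a) eq (here refl) with Lₚ.∷-injectiveˡ eq
... | refl = _ , stop a , λ { (here refl) → here refl }
prefix-within {xs = x ∷ xs} (r ∷ c) eq (here refl) with Lₚ.∷-injectiveˡ eq
... | refl = _ , stop _ , λ { (here refl) → here refl }
prefix-within {xs = x ∷ _ ∷ xs} (stop a) () (there m)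
prefix-within {xs = x ∷ xs} (r ∷ c) eq (there m) with Lₚ.∷-injectiveˡ eq | prefix-within c (Lₚ.∷-injectiveʳ eq) m
... | refl | ws , d , sub = _ , r ∷ d , λ { (here refl) → here refl ; (there k) → there (sub k) }

suffix-within : ∀ {V : Set} {R : V → V → Set} {a b x xs w} → Chain R a b (x ∷ xs) → w ∈ xs →
  ∃[ ws ] (Chain R w b ws × ∀ {v} → v ∈ ws → v ∈ xs)
suffix-within (_ ∷ c) m = suffix c m

inner-ends : ∀ {V : Set} {R : V → V → Set} {a b xs v} → Chain R a b xs → Unique xs → v ∈ inner xs →
  v ∈ xs × v ≢ a × v ≢ b
inner-ends (r ∷ c) (px ∷ u) m = let p , q = drop c u m in there p , (λ { refl → All.lookup px p refl }) , q
  where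
  drop : ∀ {V : Set} {R : V → V → Set} {a b xs v} → Chain R a b xs → Unique xs → v ∈ dropLast xs → v ∈ xs × v ≢ b
  drop (_ ∷ stop _) (px ∷ _) (here refl) = here refl , All.lookup px (here refl)
  drop (r ∷ (r′ ∷ c)) (px ∷ u) (here refl) = here refl , All.lookup px (last∈ (r′ ∷ c))
  drop (r ∷ (r′ ∷ c)) (px ∷ u) (there m) = let p , q = drop (r′ ∷ c) u m in there p , q

reverse-unique : ∀ {V : Set} {xs : List V} → Unique xs → Unique (reverse xs)
reverse-unique [] = []
reverse-unique {xs = x ∷ xs} (px ∷ u) = subst Unique (sym (Lₚ.unfold-reverse x xs))
  (Uₚ.++⁺ (reverse-unique u) ([] ∷ []) λ { (p , here refl) → All.lookup px (∈-reverse⁻ p) refl })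

-- Menger's theorem for digraphs

module Menger {V : Set} (_≟_ : DecidableEquality V) where

  _∈?_ : (v : V) (xs : List V) → Dec (v ∈ xs)
  _∈?_ = DecMem._∈?_ _≟_

  Arc : List (V × V) → V → V → Set
  Arc E x y = (x , y) ∈ E

  record Linkage (E : List (V × V)) (A B : List V) (k : ℕ) : Set where
    field
      path     : Fin k → List V
      from to  : Fin k → V
      chain    : ∀ i → Chain (Arc E) (from i) (to i) (path i)
      from∈    : ∀ i → from i ∈ A
      to∈      : ∀ i → to i ∈ B
      disjoint : ∀ {i j v} → v ∈ path i → v ∈ path j → i ≡ j

  Separates : List (V × V) → List V → List V → List V → Set
  Separates E A B S = ∀ {a b xs} → a ∈ A → b ∈ B → Chain (Arc E) a b xs → ∃[ v ] (v ∈ xs × v ∈ S)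

  -- The two pieces are the parts before the first and after the last use of the new arc, so both
  -- are walks in `E`.
  split-at-arc : ∀ {x y E a b xs} → Chain (Arc ((x , y) ∷ E)) a b xs → Chain (Arc E) a b xs ⊎
    ∃[ ys ] ∃[ zs ] (Chain (Arc E) a x ys × Chain (Arc E) y b zs ×
      (∀ {v} → v ∈ ys → v ∈ xs) × (∀ {v} → v ∈ zs → v ∈ xs))
  split-at-arc (stop a) = inj₁ (stop a)
  split-at-arc (here refl ∷ c) with split-at-arc c
  ... | inj₁ d = inj₂ (_ , _ , stop _ , d , (λ { (here refl) → here refl }) , there)
  ... | inj₂ (_ , _ , _ , d , _ , sub) = inj₂ (_ , _ , stop _ , d , (λ { (here refl) → here refl }) , there ∘ sub)
  split-at-arc (there r ∷ c) with split-at-arc c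
  ... | inj₁ d = inj₁ (r ∷ d)
  ... | inj₂ (_ , _ , d , d′ , sub , sub′) =
    inj₂ (_ , _ , r ∷ d , d′ , (λ { (here refl) → here refl ; (there m) → there (sub m) }) , there ∘ sub′)

  module Combine {E : List (V × V)} {A B S : List V} {x y : V} {k : ℕ} (sep : Separates E A B S)
    (full : suc (length S) ≡ k) (L₁ : Linkage E A (x ∷ S) k) (L₂ : Linkage E (y ∷ S) B k) where

    module L₁ = Linkage L₁
    module L₂ = Linkage L₂

    left : ∀ i → _
    left i = first-hit (_∈? (x ∷ S)) (L₁.chain i) (L₁.to∈ i)

    right′ : ∀ i → _
    right′ i = last-hit (_∈? (y ∷ S)) (L₂.chain i)

    right : ∀ i → ∃[ c ] ∃[ ys ] (Chain (Arc E) c (L₂.to i) ys × c ∈ (y ∷ S) × (∀ {v} → v ∈ ys → v ∈ L₂.path i) ×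
        (∀ {v} → v ∈ ys → v ≡ c ⊎ (v ∉ (y ∷ S) × ∃[ zs ] (Chain (Arc E) v (L₂.to i) zs × ∀ {w} → w ∈ zs → w ∉ (y ∷ S)))))
    right i with right′ i
    ... | inj₁ av = ⊥-elim (av (head∈ (L₂.chain i)) (L₂.from∈ i))
    ... | inj₂ r  = r

    end start : Fin k → V
    end i   = proj₁ (left i)
    start i = proj₁ (right i)
    lp rp : Fin k → List V
    lp i = proj₁ (proj₂ (left i))
    rp i = proj₁ (proj₂ (right i))
    lc : ∀ i → Chain (Arc E) (L₁.from i) (end i) (lp i)
    lc i = proj₁ (proj₂ (proj₂ (left i)))
    rc : ∀ i → Chain (Arc E) (start i) (L₂.to i) (rp i)
    rc i = proj₁ (proj₂ (proj₂ (right i)))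
    end∈ : ∀ i → end i ∈ (x ∷ S)
    end∈ i = proj₁ (proj₂ (proj₂ (proj₂ (left i))))
    start∈ : ∀ i → start i ∈ (y ∷ S)
    start∈ i = proj₁ (proj₂ (proj₂ (proj₂ (right i))))
    lsub : ∀ i {v} → v ∈ lp i → v ∈ L₁.path i
    lsub i = proj₁ (proj₂ (proj₂ (proj₂ (proj₂ (left i)))))
    rsub : ∀ i {v} → v ∈ rp i → v ∈ L₂.path i
    rsub i = proj₁ (proj₂ (proj₂ (proj₂ (proj₂ (right i)))))
    loff : ∀ i {v} → v ∈ lp i → _
    loff i = proj₂ (proj₂ (proj₂ (proj₂ (proj₂ (left i)))))
    roff : ∀ i {v} → v ∈ rp i → _
    roff i = proj₂ (proj₂ (proj₂ (proj₂ (proj₂ (right i)))))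

    end-inj : ∀ {i j} → end i ≡ end j → i ≡ j
    end-inj {i} {j} eq = L₁.disjoint (lsub i (last∈ (lc i))) (subst (_∈ L₁.path j) (sym eq) (lsub j (last∈ (lc j))))
    start-inj : ∀ {i j} → start i ≡ start j → i ≡ j
    start-inj {i} {j} eq = L₂.disjoint (rsub i (head∈ (rc i))) (subst (_∈ L₂.path j) (sym eq) (rsub j (head∈ (rc j))))

    -- `S` has only `k - 1` entries, too few for `k` distinct values, so the added vertex `z` is
    -- really new.
    overfull : (f : Fin k → V) → (∀ {i j} → f i ≡ f j → i ≡ j) → ∀ z → (∀ i → f i ∈ (z ∷ S)) → z ∉ S
    overfull f inj z f∈ z∈ = ℕₚ.<-irrefl refl (ℕₚ.≤-trans (ℕₚ.≤-reflexive full)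
      (injection-length f S inj λ i → [ (λ { refl → z∈ }) , id ]′ (∷⁻ (f∈ i))))
      where
      ∷⁻ : ∀ {v} → v ∈ (z ∷ S) → v ≡ z ⊎ v ∈ S
      ∷⁻ (here eq) = inj₁ eq
      ∷⁻ (there m) = inj₂ m

    x∉S : x ∉ S
    x∉S = overfull end end-inj x end∈
    y∉S : y ∉ S
    y∉S = overfull start start-inj y start∈

    lp-x-avoids : ∀ i → end i ≡ x → ∀ {v} → v ∈ lp i → v ∉ S
    lp-x-avoids i eq m v∈S with loff i m
    ... | inj₁ refl = x∉S (subst (_∈ S) eq v∈S)
    ... | inj₂ (¬p , _) = ¬p (there v∈S)

    rp-y-avoids : ∀ i → start i ≡ y → ∀ {v} → v ∈ rp i → v ∉ S
    rp-y-avoids i eq m v∈S with roff i m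
    ... | inj₁ refl = y∉S (subst (_∈ S) eq v∈S)
    ... | inj₂ (¬p , _) = ¬p (there v∈S)

    no-cross : ∀ i j {v xs ys} → Chain (Arc E) (L₁.from i) v xs → Chain (Arc E) v (L₂.to j) ys →
      (∀ {w} → w ∈ xs → w ∉ S) → (∀ {w} → w ∈ ys → w ∉ S) → ⊥
    no-cross i j c d av av′ with join c d
    ... | zs , e , sub with sep (L₁.from∈ i) (L₂.to∈ j) e
    ...   | w , w∈ , w∈S = [ (λ m → av m w∈S) , (λ m → av′ m w∈S) ]′ (sub w∈)

    Match : Fin k → Fin k → Set
    Match i j = (end i ≡ x × start j ≡ y) ⊎ (end i ∈ S × start j ≡ end i)

    -- The `k` distinct starts lie among the `k` entries of `y ∷ S` and hence use up all of them, so
    -- each left part finds its continuation.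
    match : ∀ i → ∃[ j ] Match i j
    match i with end∈ i
    ... | here eq = let j , eq′ = onto _≟_ start (y ∷ S) start-inj start∈ (ℕₚ.≤-reflexive full) (here refl)
                    in j , inj₁ (eq , eq′)
    ... | there m = let j , eq′ = onto _≟_ start (y ∷ S) start-inj start∈ (ℕₚ.≤-reflexive full) (there m)
                    in j , inj₂ (m , eq′)

    -- If a left and a right part met anywhere but at their junction, they could be spliced into a
    -- walk from `A` to `B` in `E` that misses `S`. So only parts that are glued anyway can meet.
    meet : ∀ {i j v} → v ∈ lp i → v ∈ rp j → Match i j
    meet {i} {j} m m′ with loff i m | roff j m′
    ... | inj₂ (_ , _ , c , av) | inj₂ (_ , _ , d , av′) =
          ⊥-elim (no-cross i j c d (λ w s → av w (there s)) (λ w s → av′ w (there s)))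
    ... | inj₁ refl | inj₂ (¬p , _ , d , av′) with end∈ i
    ...   | here eq = ⊥-elim (no-cross i j (lc i) d (lp-x-avoids i eq) (λ w s → av′ w (there s)))
    ...   | there s = ⊥-elim (¬p (there s))
    meet {i} {j} m m′ | inj₂ (¬p , _ , c , av) | inj₁ refl with start∈ j
    ...   | here eq = ⊥-elim (no-cross i j c (rc j) (λ w s → av w (there s)) (rp-y-avoids j eq))
    ...   | there s = ⊥-elim (¬p (there s))
    meet {i} {j} m m′ | inj₁ eq | inj₁ eq′ with end∈ i | start∈ j
    ...   | here p | here q = inj₁ (p , q)
    ...   | there s | _ = inj₂ (s , trans (sym eq′) eq)
    ...   | here p | there s = ⊥-elim (x∉S (subst (_∈ S) (trans (sym eq′) (trans eq p)) s))

    match-inj : ∀ {i i′ j} → Match i j → Match i′ j → i ≡ i′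
    match-inj (inj₁ (p , _)) (inj₁ (q , _)) = end-inj (trans p (sym q))
    match-inj (inj₂ (_ , p)) (inj₂ (_ , q)) = end-inj (trans (sym p) q)
    match-inj (inj₁ (_ , p)) (inj₂ (s , q)) = ⊥-elim (y∉S (subst (_∈ S) (trans (sym q) p) s))
    match-inj (inj₂ (s , q)) (inj₁ (_ , p)) = ⊥-elim (y∉S (subst (_∈ S) (trans (sym q) p) s))

    whole : ∀ i → ∃[ zs ] (Chain (Arc ((x , y) ∷ E)) (L₁.from i) (L₂.to (proj₁ (match i))) zs ×
      ∀ {v} → v ∈ zs → v ∈ lp i ⊎ v ∈ rp (proj₁ (match i)))
    whole i with match i
    ... | j , inj₁ (p , q) = lp i ++ rp j ,
            append (map-chain there (lc i)) (here (trans (cong (_, start j) p) (cong (x ,_) q))) (map-chain there (rc j)) , ∈-++⁻ (lp i)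
    ... | j , inj₂ (_ , q) =
            join (map-chain there (lc i)) (subst (λ s → Chain _ s _ _) q (map-chain there (rc j)))

    combined : Linkage ((x , y) ∷ E) A B k
    combined = record
      { path = λ i → proj₁ (whole i)
      ; from = L₁.from
      ; to = λ i → L₂.to (proj₁ (match i))
      ; chain = λ i → proj₁ (proj₂ (whole i))
      ; from∈ = L₁.from∈
      ; to∈ = λ i → L₂.to∈ _
      ; disjoint = λ {i} {j} m m′ → disj {i} {j} (proj₂ (proj₂ (whole i)) m) (proj₂ (proj₂ (whole j)) m′)
      }
      where
      disj : ∀ {i j v} → v ∈ lp i ⊎ v ∈ rp (proj₁ (match i)) → v ∈ lp j ⊎ v ∈ rp (proj₁ (match j)) → i ≡ j
      disj {i} {j} (inj₁ p) (inj₁ q) = L₁.disjoint (lsub i p) (lsub j q)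
      disj {i} {j} (inj₁ p) (inj₂ q) = match-inj (meet p q) (proj₂ (match j))
      disj {i} {j} (inj₂ p) (inj₁ q) = match-inj (proj₂ (match i)) (meet q p)
      disj {i} {j} (inj₂ p) (inj₂ q) =
        match-inj (proj₂ (match i)) (subst (Match j) (sym (L₂.disjoint (rsub _ p) (rsub _ q))) (proj₂ (match j)))

  -- Deleting an arc x → y leaves a separator S with one vertex too few only if both
  -- S ∪ {x} and S ∪ {y} separate; the two linkages onto them are then glued along S and the arc.
  menger : ∀ E A B k → Linkage E A B k ⊎ ∃[ S ] (length S < k × Separates E A B S)
  -- Without arcs only one-vertex walks exist: the distinct elements common to `A` and `B` serve
  -- both as paths and as separator.
  menger [] A B k with deduplicate _≟_ (filter (_∈? B) A) in eq
  ... | I with ℕₚ.<-≤-connex (length I) k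
  ...   | inj₁ lt = inj₂ (I , lt , λ { a∈ b∈ (stop a) → a , here refl ,
            subst (a ∈_) eq (∈-deduplicate⁺ _≟_ (∈-filter⁺ (_∈? B) a∈ b∈)) ; _ _ (() ∷ _) })
  ...   | inj₂ le = inj₁ (record
            { path = λ i → f i ∷ []
            ; from = f ; to = f ; chain = λ i → stop (f i)
            ; from∈ = λ i → proj₁ (f∈ i) ; to∈ = λ i → proj₂ (f∈ i)
            ; disjoint = λ { (here p) (here q) → Fₚ.inject≤-injective le le _ _
                 (Unique-lookup (subst Unique eq (deduplicate-! _≟_ (filter (_∈? B) A))) (trans (sym p) q)) } })
      where
      f : Fin k → V
      f i = lookup I (inject≤ i le)
      f∈ : ∀ i → f i ∈ A × f i ∈ B
      f∈ i = ∈-filter⁻ (_∈? B) (∈-deduplicate⁻ _≟_ (filter (_∈? B) A) (subst (f i ∈_) (sym eq) (∈-lookup _)))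
  menger ((x , y) ∷ E) A B k with menger E A B k
  ... | inj₁ L = inj₁ (record { Linkage L ; chain = λ i → map-chain there (Linkage.chain L i) })
  ... | inj₂ (S , lt , sep) with menger E A (x ∷ S) k | menger E (y ∷ S) B k
  ...   | inj₂ (T , lt′ , sep′) | _ = inj₂ (T , lt′ , sepT)
      where
      sepT : Separates ((x , y) ∷ E) A B T
      sepT a∈ b∈ c with split-at-arc c
      ... | inj₂ (ys , _ , d , _ , sub , _) = let v , v∈ , v∈T = sep′ a∈ (here refl) d in v , sub v∈ , v∈T
      ... | inj₁ d with sep a∈ b∈ d
      ...   | w , w∈ , w∈S with prefix d w∈
      ...     | ys , e , sub = let v , v∈ , v∈T = sep′ a∈ (there w∈S) e in v , sub v∈ , v∈T
  ...   | inj₁ _ | inj₂ (T , lt′ , sep′) = inj₂ (T , lt′ , sepT)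
      where
      sepT : Separates ((x , y) ∷ E) A B T
      sepT a∈ b∈ c with split-at-arc c
      ... | inj₂ (_ , zs , _ , d , _ , sub) = let v , v∈ , v∈T = sep′ (here refl) b∈ d in v , sub v∈ , v∈T
      ... | inj₁ d with sep a∈ b∈ d
      ...   | w , w∈ , w∈S with suffix d w∈
      ...     | ys , e , sub = let v , v∈ , v∈T = sep′ (there w∈S) b∈ e in v , sub v∈ , v∈T
  ...   | inj₁ L₁ | inj₁ L₂ with ℕₚ.m≤n⇒m<n∨m≡n lt
  ...     | inj₂ full = inj₁ (Combine.combined sep full L₁ L₂)
  -- `S` has fewer than `k - 1` entries, so there is room for `x`, which lies on every walk through
  -- the new arc.
  ...     | inj₁ lt′ = inj₂ (x ∷ S , lt′ , sepX)
      where
      sepX : Separates ((x , y) ∷ E) A B (x ∷ S)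
      sepX a∈ b∈ c with split-at-arc c
      ... | inj₂ (_ , _ , d , _ , sub , _) = x , sub (last∈ d) , here refl
      ... | inj₁ d = let v , v∈ , v∈S = sep a∈ b∈ d in v , v∈ , there v∈S

-- Routings between gates and cuts

-- Menger's theorem with k virtual sources and sinks, each attached to the vertices of its gate.
-- Repeating a gate expresses that a vertex is to be reached several times.
module Gates {n : ℕ} (_~_ : Fin n → Fin n → Set) (_~?_ : ∀ x y → Dec (x ~ y)) where

  Conn : (Fin n → Set) → Fin n → Fin n → Set
  Conn X a b = ∃[ xs ] (Chain _~_ a b xs × ∀ {v} → v ∈ xs → X v)

  Node : ℕ → Set
  Node k = Fin k ⊎ (Fin n ⊎ Fin k)

  pattern src i = inj₁ i
  pattern vtx v = inj₂ (inj₁ v)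
  pattern snk j = inj₂ (inj₂ j)

  _≟ᴺ_ : ∀ {k} → DecidableEquality (Node k)
  _≟ᴺ_ = ⊎ₚ.≡-dec Fₚ._≟_ (⊎ₚ.≡-dec Fₚ._≟_ Fₚ._≟_)

  _∈ᴺ?_ : ∀ {k} (s : Node k) (S : List (Node k)) → Dec (s ∈ S)
  _∈ᴺ?_ = Menger._∈?_ _≟ᴺ_

  verts : ∀ {k} → List (Node k) → List (Fin n)
  verts []           = []
  verts (vtx v ∷ S)  = v ∷ verts S
  verts (src _ ∷ S)  = verts S
  verts (snk _ ∷ S)  = verts S

  verts-length : ∀ {k} (S : List (Node k)) → length (verts S) ≤ length S
  verts-length []          = z≤n
  verts-length (vtx v ∷ S) = s≤s (verts-length S)
  verts-length (src _ ∷ S) = ℕₚ.m≤n⇒m≤1+n (verts-length S)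
  verts-length (snk _ ∷ S) = ℕₚ.m≤n⇒m≤1+n (verts-length S)

  verts⁺ : ∀ {k} {S : List (Node k)} {v} → vtx v ∈ S → v ∈ verts S
  verts⁺ {S = vtx _ ∷ _} (here refl) = here refl
  verts⁺ {S = vtx _ ∷ _} (there m)   = there (verts⁺ m)
  verts⁺ {S = src _ ∷ _} (there m)   = verts⁺ m
  verts⁺ {S = snk _ ∷ _} (there m)   = verts⁺ m

  verts⁻ : ∀ {k} {S : List (Node k)} {v} → v ∈ verts S → vtx v ∈ S
  verts⁻ {S = vtx _ ∷ _} (here refl) = here refl
  verts⁻ {S = vtx _ ∷ _} (there m)   = there (verts⁻ m)
  verts⁻ {S = src _ ∷ _} m           = there (verts⁻ m)
  verts⁻ {S = snk _ ∷ _} m           = there (verts⁻ m)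

  module _ {k : ℕ} (X : Fin n → Set) (Src Snk : Fin k → Fin n → Set) where

    -- Indexed by the sinks. Menger's theorem does not say which source is joined to which sink;
    -- `origin` records the resulting permutation, and distinct kinds of sources force a case
    -- distinction on it.
    record Routing : Set where
      field
        path       : Fin k → List (Fin n)
        from to    : Fin k → Fin n
        origin     : Fin k → Fin k
        chain      : ∀ j → Chain _~_ (from j) (to j) (path j)
        from-src   : ∀ j → Src (origin j) (from j)
        to-snk     : ∀ j → Snk j (to j)
        inside     : ∀ j {v} → v ∈ path j → X v
        disjoint   : ∀ {i j v} → v ∈ path i → v ∈ path j → i ≡ j
        origin-inj : ∀ {i j} → origin i ≡ origin j → i ≡ j

    -- A gate costs one element of `S`, like a vertex, however many vertices belong to it; `blocks`
    -- speaks only of the gates that are left open.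
    record Cut : Set where
      field
        S       : List (Node k)
        small   : length S < k
        within  : ∀ {v} → v ∈ verts S → X v
        blocks  : ∀ {i j a b} → src i ∉ S → snk j ∉ S → Src i a → Snk j b →
                  Conn (λ v → X v × v ∉ verts S) a b → ⊥

      missing : (f : Fin k → Node k) → (∀ {i j} → f i ≡ f j → i ≡ j) → ∃[ i ] f i ∉ S
      missing f inj with Fₚ.any? (λ i → ¬? (f i ∈ᴺ? S))
      ... | yes p = p
      ... | no ¬p = ⊥-elim (ℕₚ.<-irrefl refl (ℕₚ.≤-trans small
              (injection-length f S inj λ i → decidable-stable (f i ∈ᴺ? S) λ i∉ → ¬p (i , i∉))))

      free-source : ∃[ i ] src i ∉ S
      free-source = missing src λ { refl → refl }

      free-sink : ∃[ j ] snk j ∉ S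
      free-sink = missing snk λ { refl → refl }

      -- m disjoint routes need m elements of S, and one more if S contains an element on none of them
      module Crossing {m : ℕ} (α β : Fin m → Fin k) (p : Fin m → List (Fin n))
        (α-inj : ∀ {i j} → α i ≡ α j → i ≡ j) (β-inj : ∀ {i j} → β i ≡ β j → i ≡ j)
        (disj : ∀ {i j v} → v ∈ p i → v ∈ p j → i ≡ j)
        (route : ∀ i → ∃[ a ] ∃[ b ] (Chain _~_ a b (p i) × Src (α i) a × Snk (β i) b))
        (inX : ∀ i {v} → v ∈ p i → X v) where

        On : Fin m → Node k → Set
        On i (src i′) = i′ ≡ α i
        On i (vtx v)  = v ∈ p i
        On i (snk j)  = j ≡ β i

        hit : ∀ i → ∃[ s ] (s ∈ S × On i s)
        hit i with src (α i) ∈ᴺ? S | snk (β i) ∈ᴺ? S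
        ... | yes s | _ = _ , s , refl
        ... | no _ | yes s = _ , s , refl
        ... | no s | no t with Fₚ.any? (λ v → Menger._∈?_ Fₚ._≟_ v (p i) ×-dec (vtx v ∈ᴺ? S))
        ...   | yes (v , v∈ , v∈S) = _ , v∈S , v∈
        ...   | no none = let a , b , c , sa , sb = route i in
                  ⊥-elim (blocks s t sa sb (p i , c , λ v∈ → inX i v∈ , λ v∈S → none (_ , v∈ , verts⁻ v∈S)))

        On-inj : ∀ {i j} s → On i s → On j s → i ≡ j
        On-inj (src _) p q = α-inj (trans (sym p) q)
        On-inj (vtx _) p q = disj p q
        On-inj (snk _) p q = β-inj (trans (sym p) q)

        hit-inj : ∀ {i j} → proj₁ (hit i) ≡ proj₁ (hit j) → i ≡ j
        hit-inj {i} {j} eq = On-inj _ (proj₂ (proj₂ (hit i))) (subst (On j) (sym eq) (proj₂ (proj₂ (hit j))))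

        bound : m ≤ length S
        bound = injection-length (proj₁ ∘ hit) S hit-inj (λ i → proj₁ (proj₂ (hit i)))

        strict-bound : ∀ {s} → s ∈ S → (∀ i → ¬ On i s) → suc m ≤ length S
        strict-bound {s} s∈ off = suc-injection (proj₁ ∘ hit) s hit-inj
          (λ i eq → off i (subst (On i) eq (proj₂ (proj₂ (hit i))))) S (λ i → proj₁ (proj₂ (hit i))) s∈

    module _ (X? : Decidable X) (Src? : ∀ i → Decidable (Src i)) (Snk? : ∀ j → Decidable (Snk j)) where

      -- No arc enters a source or leaves a sink, so a walk from a source to a sink meets gates at
      -- its two ends only and decodes to a walk of graph vertices.
      Edge : Node k → Node k → Set
      Edge (src i) (vtx v) = Src i v × X v
      Edge (vtx u) (vtx v) = X u × X v × u ~ v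
      Edge (vtx u) (snk j) = X u × Snk j u
      Edge _       _       = ⊥

      Edge? : ∀ u v → Dec (Edge u v)
      Edge? (src i) (vtx v) = Src? i v ×-dec X? v
      Edge? (vtx u) (vtx v) = X? u ×-dec (X? v ×-dec (u ~? v))
      Edge? (vtx u) (snk j) = X? u ×-dec Snk? j u
      Edge? (src _) (src _) = no id
      Edge? (src _) (snk _) = no id
      Edge? (vtx _) (src _) = no id
      Edge? (snk _) _       = no id

      nodes : List (Node k)
      nodes = map src (allFin k) ++ map vtx (allFin n) ++ map snk (allFin k)

      ∈-nodes : ∀ v → v ∈ nodes
      ∈-nodes (src i) = ∈-++⁺ˡ (∈-map⁺ src (∈-allFin i))
      ∈-nodes (vtx v) = ∈-++⁺ʳ (map src (allFin k)) (∈-++⁺ˡ (∈-map⁺ vtx (∈-allFin v)))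
      ∈-nodes (snk j) = ∈-++⁺ʳ (map src (allFin k)) (∈-++⁺ʳ (map vtx (allFin n)) (∈-map⁺ snk (∈-allFin j)))

      Edge?′ : Decidable (λ (e : Node k × Node k) → Edge (proj₁ e) (proj₂ e))
      Edge?′ (u , v) = Edge? u v

      arcs : List (Node k × Node k)
      arcs = filter Edge?′ (cartesianProduct nodes nodes)

      open Menger (_≟ᴺ_ {k}) using (Arc; Linkage; menger)

      arc⁺ : ∀ {u v} → Edge u v → Arc arcs u v
      arc⁺ e = ∈-filter⁺ Edge?′ (∈-cartesianProduct⁺ (∈-nodes _) (∈-nodes _)) e

      arc⁻ : ∀ {u v} → Arc arcs u v → Edge u v
      arc⁻ m = proj₂ (∈-filter⁻ Edge?′ {xs = cartesianProduct nodes nodes} m)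

      decode-tail : ∀ {a j xs} → Chain Edge (vtx a) (snk j) xs →
        ∃[ b ] ∃[ ys ] (Chain _~_ a b ys × Snk j b × ∀ {v} → v ∈ ys → X v × vtx v ∈ xs)
      decode-tail (_∷_ {b = snk j} (xa , s) (stop _)) = _ , _ , stop _ , s , λ { (here refl) → xa , here refl }
      decode-tail (_∷_ {b = vtx v} (xa , _ , r) c) with decode-tail c
      ... | b , ys , d , s , inx = b , _ , r ∷ d , s ,
            λ { (here refl) → xa , here refl ; (there m) → proj₁ (inx m) , there (proj₂ (inx m)) }
      decode-tail (_∷_ {b = snk j} (xa , s) (_∷_ {b = src _} () _))
      decode-tail (_∷_ {b = snk j} (xa , s) (_∷_ {b = vtx _} () _))
      decode-tail (_∷_ {b = snk j} (xa , s) (_∷_ {b = snk _} () _))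

      decode : ∀ {i j xs} → Chain Edge (src i) (snk j) xs →
        ∃[ a ] ∃[ b ] ∃[ ys ] (Src i a × Chain _~_ a b ys × Snk j b × ∀ {v} → v ∈ ys → X v × vtx v ∈ xs)
      decode (_∷_ {b = vtx a} (s , _) c) with decode-tail c
      ... | b , ys , d , t , inx = a , b , ys , s , d , t , λ m → proj₁ (inx m) , there (proj₂ (inx m))

      encode-tail : ∀ {a b j ys} → Chain _~_ a b ys → (∀ {v} → v ∈ ys → X v) → Snk j b →
        Chain Edge (vtx a) (snk j) (map vtx ys ++ snk j ∷ [])
      encode-tail (stop a) inx t = (inx (here refl) , t) ∷ stop _
      encode-tail (r ∷ c) inx t = (inx (here refl) , inx (there (head∈ c)) , r) ∷ encode-tail c (inx ∘ there) t

      route : Routing ⊎ Cut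
      route with menger arcs (map src (allFin k)) (map snk (allFin k)) k
      ... | inj₂ (S , lt , sep) = inj₂ (record
              -- Vertices outside `X` carry no arcs, so discarding them leaves a separator and
              -- secures `within`.
              { S = filter keep? S
              ; small = ℕₚ.≤-trans (s≤s (Lₚ.length-filter keep? S)) lt
              ; within = λ m → proj₂ (∈-filter⁻ keep? {xs = S} (verts⁻ m))
              ; blocks = blk })
          where
          Keep : Node k → Set
          Keep (vtx v) = X v
          Keep (src _) = ⊤
          Keep (snk _) = ⊤
          keep? : Decidable Keep
          keep? (vtx v) = X? v
          keep? (src _) = yes tt
          keep? (snk _) = yes tt
          blk : ∀ {i j a b} → src i ∉ filter keep? S → snk j ∉ filter keep? S → Src i a → Snk j b →
                  Conn (λ v → X v × v ∉ verts (filter keep? S)) a b → ⊥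
          blk {i} {j} i∉ j∉ s t (ys , c , av)
            with sep (∈-map⁺ src (∈-allFin i)) (∈-map⁺ snk (∈-allFin j))
                   (map-chain arc⁺ (_∷_ {a = src i} (s , proj₁ (av (head∈ c))) (encode-tail c (proj₁ ∘ av) t)))
          ... | _ , here refl , v∈S = i∉ (∈-filter⁺ keep? v∈S tt)
          ... | _ , there m , v∈S with ∈-++⁻ (map vtx ys) m
          ...   | inj₂ (here refl) = j∉ (∈-filter⁺ keep? v∈S tt)
          ...   | inj₁ m′ with ∈-map⁻ vtx m′
          ...     | w , w∈ , refl = proj₂ (av w∈) (verts⁺ (∈-filter⁺ keep? v∈S (proj₁ (av w∈))))
      ... | inj₁ L = inj₁ (record
              { path = λ j → proj₁ (proj₂ (proj₂ (D j)))
              ; from = λ j → proj₁ (D j)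
              ; to = λ j → proj₁ (proj₂ (D j))
              ; origin = λ j → proj₁ (S j)
              ; chain = λ j → proj₁ (proj₂ (proj₂ (proj₂ (proj₂ (D j)))))
              ; from-src = λ j → proj₁ (proj₂ (proj₂ (proj₂ (D j))))
              ; to-snk = λ j → proj₁ (proj₂ (proj₂ (proj₂ (proj₂ (proj₂ (D j))))))
              ; inside = λ j m → proj₁ (sub j m)
              ; disjoint = λ {i} {j} m m′ → ix-inj (L.disjoint (proj₂ (sub i m)) (proj₂ (sub j m′)))
              ; origin-inj = λ {i} {j} eq → ix-inj (L.disjoint (head∈ (L.chain (ix i)))
                  (subst (_∈ L.path (ix j)) (sym (trans (proj₂ (S i)) (trans (cong src eq) (sym (proj₂ (S j))))))
                    (head∈ (L.chain (ix j)))))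
              })
          where
          module L = Linkage L
          to-inj : ∀ {i j} → L.to i ≡ L.to j → i ≡ j
          to-inj {i} {j} eq = L.disjoint (last∈ (L.chain i)) (subst (_∈ L.path j) (sym eq) (last∈ (L.chain j)))
          len : length {A = Node k} (map snk (allFin k)) ≤ k
          len = ℕₚ.≤-reflexive (trans (Lₚ.length-map snk (allFin k)) (Lₚ.length-tabulate id))
          -- `k` disjoint paths into `k` sinks end in every sink, which allows renumbering them by
          -- their ends.
          index-of : ∀ j → ∃[ i ] L.to i ≡ snk j
          index-of j = onto _≟ᴺ_ L.to (map snk (allFin k)) to-inj L.to∈ len (∈-map⁺ snk (∈-allFin j))
          ix : Fin k → Fin k
          ix j = proj₁ (index-of j)
          ix-inj : ∀ {i j} → ix i ≡ ix j → i ≡ j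
          ix-inj {i} {j} eq with trans (sym (proj₂ (index-of i))) (trans (cong L.to eq) (proj₂ (index-of j)))
          ... | refl = refl
          S : ∀ j → ∃[ i ] L.from (ix j) ≡ src i
          S j = let i , _ , eq = ∈-map⁻ src (L.from∈ (ix j)) in i , eq
          enc : ∀ j → Chain Edge (src (proj₁ (S j))) (snk j) (L.path (ix j))
          enc j = recast (proj₂ (S j)) (proj₂ (index-of j)) (map-chain arc⁻ (L.chain (ix j)))
          D : ∀ j → _
          D j = decode (enc j)
          sub : ∀ j {v} → v ∈ proj₁ (proj₂ (proj₂ (D j))) → X v × vtx v ∈ L.path (ix j)
          sub j = proj₂ (proj₂ (proj₂ (proj₂ (proj₂ (proj₂ (D j))))))

  -- Menger's theorem with one gate at each end is a decision procedure: a cut with fewer than one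
  -- element is empty and blocks every walk.
  conn? : ∀ {X} → Decidable X → ∀ a b → Dec (Conn X a b)
  conn? {X} X? a b with route {1} X (λ _ v → v ≡ a) (λ _ v → v ≡ b) X? (λ _ v → v Fₚ.≟ a) (λ _ v → v Fₚ.≟ b)
  ... | inj₁ r = yes (_ , recast (from-src zero) (to-snk zero) (chain zero) , inside zero)
    where open Routing r
  ... | inj₂ record { S = [] ; blocks = blk } = no λ (xs , c , inx) →
          blk {zero} {zero} (λ ()) (λ ()) refl refl (xs , c , λ m → inx m , λ ())
  ... | inj₂ record { S = _ ∷ _ ; small = s≤s () }

-- Links, pairs of walks and kites in an 8-connected graph

module Graph {n : ℕ} (_~_ : Fin n → Fin n → Set) (_~?_ : ∀ x y → Dec (x ~ y))
  (~-sym : ∀ {x y} → x ~ y → y ~ x) (~-irrefl : ∀ {x} → ¬ (x ~ x)) (8<n : 8 < n)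
  (connected : ∀ S → length S < 8 → ∀ {a b} → a ∉ S → b ∉ S →
     ∃[ xs ] (Chain _~_ a b xs × Unique xs × ∀ {v} → v ∈ xs → v ∉ S)) where

  open Gates _~_ _~?_ public

  V : Set
  V = Fin n

  _∈?_ : (v : V) (xs : List V) → Dec (v ∈ xs)
  _∈?_ = Menger._∈?_ Fₚ._≟_

  conn-refl : ∀ {X : V → Set} {a} → X a → Conn X a a
  conn-refl xa = _ , stop _ , λ { (here refl) → xa }

  conn-head : ∀ {X a b} → Conn X a b → X a
  conn-head (_ , c , inx) = inx (head∈ c)

  conn-last : ∀ {X a b} → Conn X a b → X b
  conn-last (_ , c , inx) = inx (last∈ c)

  conn-mono : ∀ {X Y : V → Set} → (∀ {v} → X v → Y v) → ∀ {a b} → Conn X a b → Conn Y a b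
  conn-mono f (xs , c , inx) = xs , c , f ∘ inx

  conn-sym : ∀ {X a b} → Conn X a b → Conn X b a
  conn-sym (xs , c , inx) = _ , reverse-chain ~-sym c , inx ∘ ∈-reverse⁻

  conn-trans : ∀ {X a b c} → Conn X a b → Conn X b c → Conn X a c
  conn-trans (_ , c , inx) (_ , d , inx′) = let zs , e , sub = join c d in zs , e , [ inx , inx′ ]′ ∘ sub

  conn-append : ∀ {X a b c d} → Conn X a b → b ~ c → Conn X c d → Conn X a d
  conn-append (xs , c , inx) r (_ , d , inx′) = _ , append c r d , [ inx , inx′ ]′ ∘ ∈-++⁻ xs

  conn-snoc : ∀ {X : V → Set} {a b c} → Conn X a b → b ~ c → X c → Conn X a c
  conn-snoc p r xc = conn-append p r (conn-refl xc)

  chain-to : ∀ {a b v xs} → Chain _~_ a b xs → v ∈ xs → Conn (_∈ xs) a v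
  chain-to = prefix

  chain-from : ∀ {a b v xs} → Chain _~_ a b xs → v ∈ xs → Conn (_∈ xs) v b
  chain-from = suffix

  Link : (V → Set) → V → V → Set
  Link X s t = ∃[ a ] ∃[ b ] (s ~ a × Conn X a b × b ~ t)

  link-sym : ∀ {X s t} → Link X s t → Link X t s
  link-sym (a , b , r , c , r′) = b , a , ~-sym r′ , conn-sym c , ~-sym r

  -- A path from `u` to `x` whose interior lies in `X` and may be empty, which a `Link` cannot
  -- express.
  Att : (V → Set) → V → V → Set
  Att X u x = u ~ x ⊎ Link X u x

  att-link : ∀ {X Y Z : V → Set} → (∀ {v} → X v → Z v) → (∀ {v} → Y v → Z v) →
    ∀ {u x y t} → Att X u x → Conn Y x y → y ~ t → Link Z u t
  att-link f g (inj₁ r) c r′ = _ , _ , r , conn-mono g c , r′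
  att-link f g (inj₂ (a , b , r , d , r″)) c r′ = a , _ , r , conn-append (conn-mono f d) r″ (conn-mono g c) , r′

  enter : ∀ {P : V → Set} → Decidable P → ∀ {a b xs} → Chain _~_ a b xs → ¬ P a → P b →
    ∃[ c ] ∃[ d ] (Conn (λ v → ¬ P v × v ∈ xs) a c × c ~ d × P d × d ∈ xs)
  enter P? (stop a) ¬pa pb = ⊥-elim (¬pa pb)
  enter P? (_∷_ {b = b} r c) ¬pa pb with P? b
  ... | yes p = _ , _ , conn-refl (¬pa , here refl) , r , p , there (head∈ c)
  ... | no ¬p = let c′ , d , cn , r′ , p , d∈ = enter P? c ¬p pb
                in c′ , d , conn-append (conn-refl (¬pa , here refl)) r
                              (conn-mono (λ (q , m) → q , there m) cn) , r′ , p , there d∈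

  fresh : ∀ (S : List V) → length S < 9 → ∃[ v ] v ∉ S
  fresh S lt with Fₚ.any? (λ v → ¬? (v ∈? S))
  ... | yes p = p
  ... | no ¬p = ⊥-elim (ℕₚ.<-irrefl refl (ℕₚ.≤-trans lt (ℕₚ.≤-trans 8<n
                  (injection-length id S id λ v → decidable-stable (v ∈? S) λ v∉ → ¬p (v , v∉)))))

  -- A path that avoids `S` and leads to a vertex outside `u ∷ S` has to leave `u`; its second
  -- vertex is the neighbour.
  neighbour : ∀ u (S : List V) → length S < 8 → u ∉ S → ∃[ v ] (u ~ v × v ∉ S)
  neighbour u S lt u∉ with fresh (u ∷ S) (s≤s lt)
  ... | w , w∉ with connected S lt u∉ (w∉ ∘ there)
  ...   | _ , stop _ , _ = ⊥-elim (w∉ (here refl))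
  ...   | _ , r ∷ c , _ , av = _ , r , av (there (head∈ c))

  -- Only interiors are stored. They are nonempty, so with `u` and `v` they will close up to a
  -- cycle. The index is a `Bool` because most kites reroute walk `i` and keep the other one,
  -- `not i`.
  record Pair (u v : V) (X : V → Set) : Set where
    field
      walk    : Bool → List V
      from to : Bool → V
      chain   : ∀ i → Chain _~_ (from i) (to i) (walk i)
      u~from  : ∀ i → u ~ from i
      to~v    : ∀ i → to i ~ v
      inside  : ∀ i {w} → w ∈ walk i → X w
      apart   : ∀ i {w} → w ∈ walk i → w ∈ walk (not i) → ⊥

    link : ∀ i → Link (_∈ walk i) u v
    link i = _ , _ , u~from i , (_ , chain i , id) , to~v i

    att-u : ∀ i {c x} → c ∈ walk i → c ~ x → Att (_∈ walk i) u x
    att-u i c∈ r = inj₂ (_ , _ , u~from i , chain-to (chain i) c∈ , r)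

    att-v : ∀ i {c x} → c ∈ walk i → c ~ x → Att (_∈ walk i) v x
    att-v i c∈ r = inj₂ (_ , _ , ~-sym (to~v i) , conn-sym (chain-from (chain i) c∈) , r)

  open Pair public

  pair-mono : ∀ {u v} {X Y : V → Set} (p : Pair u v X) → (∀ i {w} → w ∈ walk p i → Y w) → Pair u v Y
  pair-mono p f = record { Pair p ; inside = f }

  pair-flip : ∀ {u v X} → Pair u v X → Pair v u X
  pair-flip p = record
    { walk = λ i → reverse (walk p i) ; from = to p ; to = from p
    ; chain = λ i → reverse-chain ~-sym (chain p i)
    ; u~from = ~-sym ∘ to~v p ; to~v = ~-sym ∘ u~from p
    ; inside = λ i → inside p i ∘ ∈-reverse⁻
    ; apart = λ i m m′ → apart p i (∈-reverse⁻ m) (∈-reverse⁻ m′) }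

  routing-pair : ∀ {k X} {Src Snk : Fin k → V → Set} (r : Routing X Src Snk) (ix : Bool → Fin k) → (∀ i → ix i ≢ ix (not i)) → ∀ {u v} →
    (∀ i → u ~ Routing.from r (ix i)) → (∀ i → Routing.to r (ix i) ~ v) → Pair u v X
  routing-pair r ix ne uf tv = record
    { walk = R.path ∘ ix ; from = R.from ∘ ix ; to = R.to ∘ ix ; chain = R.chain ∘ ix
    ; u~from = uf ; to~v = tv ; inside = R.inside ∘ ix ; apart = λ i m m′ → ne i (R.disjoint m m′) }
    where module R = Routing r

  Arms : V → V → V → (V → Set) → Set
  Arms u₁ u₂ u₃ X = Σ (Pair u₂ u₁ X) λ p → Σ (Pair u₂ u₃ X) λ q →
    ∀ i j {v} → v ∈ walk p i → v ∈ walk q j → ⊥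

  -- A kite-linkage given by four disjoint regions that contain the interiors of its paths
  record Kite (Free : V → Set) (u₁ u₂ u₃ u₄ : V) : Set₁ where
    field
      X₁ X₃ Xₘ Xₛ : V → Set
      free₁ : ∀ {v} → X₁ v → Free v
      free₃ : ∀ {v} → X₃ v → Free v
      freeₘ : ∀ {v} → Xₘ v → Free v
      freeₛ : ∀ {v} → Xₛ v → Free v
      d₁₃ : ∀ {v} → X₁ v → X₃ v → ⊥
      d₁ₘ : ∀ {v} → X₁ v → Xₘ v → ⊥
      d₁ₛ : ∀ {v} → X₁ v → Xₛ v → ⊥
      d₃ₘ : ∀ {v} → X₃ v → Xₘ v → ⊥
      d₃ₛ : ∀ {v} → X₃ v → Xₛ v → ⊥
      dₘₛ : ∀ {v} → Xₘ v → Xₛ v → ⊥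
      link₁ : Link X₁ u₂ u₁
      link₃ : Link X₃ u₂ u₃
      linkₘ : Link Xₘ u₁ u₃
      linkₛ : Link Xₛ u₂ u₄

  kite-swap : ∀ {F F′ u₁ u₂ u₃ u₄} → (∀ {v} → F v → F′ v) → Kite F u₃ u₂ u₁ u₄ → Kite F′ u₁ u₂ u₃ u₄
  kite-swap f K = record
    { X₁ = X₃ ; X₃ = X₁ ; Xₘ = Xₘ ; Xₛ = Xₛ
    ; free₁ = f ∘ free₃ ; free₃ = f ∘ free₁ ; freeₘ = f ∘ freeₘ ; freeₛ = f ∘ freeₛ
    ; d₁₃ = λ p q → d₁₃ q p ; d₁ₘ = d₃ₘ ; d₁ₛ = d₃ₛ ; d₃ₘ = d₁ₘ ; d₃ₛ = d₁ₛ ; dₘₛ = dₘₛ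
    ; link₁ = link₃ ; link₃ = link₁ ; linkₘ = link-sym linkₘ ; linkₛ = linkₛ }
    where open Kite K

  Apart : V → V → V → V → V → Set
  Apart u₁ u₂ u₃ u₄ v = v ≢ u₁ × v ≢ u₂ × v ≢ u₃ × v ≢ u₄

  Apart? : ∀ u₁ u₂ u₃ u₄ → Decidable (Apart u₁ u₂ u₃ u₄)
  Apart? u₁ u₂ u₃ u₄ v = ¬? (v Fₚ.≟ u₁) ×-dec (¬? (v Fₚ.≟ u₂) ×-dec (¬? (v Fₚ.≟ u₃) ×-dec ¬? (v Fₚ.≟ u₄)))

  -- The extremal configuration

  -- `maximal` forbids only the addition of a single vertex to `M`; every enlargement in the proof
  -- adds one end of a spare path or one vertex off the arms.
  record Setting : Set₁ where
    field
      u₁ u₂ u₃ u₄ : V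
      1≢2 : u₁ ≢ u₂
      1≢3 : u₁ ≢ u₃
      1≢4 : u₁ ≢ u₄
      2≢3 : u₂ ≢ u₃
      2≢4 : u₂ ≢ u₄
      3≢4 : u₃ ≢ u₄

    roots : V × V × V × V
    roots = u₁ , u₂ , u₃ , u₄

    Free : V → Set
    Free = Apart u₁ u₂ u₃ u₄

    field
      noKite : Kite Free u₁ u₂ u₃ u₄ → ⊥
      M : List V
      M-free : ∀ {v} → v ∈ M → Free v
      M-conn : ∀ {a b} → a ∈ M → b ∈ M → Conn (_∈ M) a b

    W : V → Set
    W v = Free v × v ∉ M

    W? : Decidable W
    W? v = Apart? u₁ u₂ u₃ u₄ v ×-dec ¬? (v ∈? M)

    Touch : V → Set
    Touch v = ∃[ m ] (m ∈ M × m ~ v)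

    Touch? : Decidable Touch
    Touch? v = Fₚ.any? (λ m → (m ∈? M) ×-dec (m ~? v))

    field
      touch₄ : Touch u₄
      arms : Arms u₁ u₂ u₃ W
      maximal : ∀ {w} → W w → Touch w → Arms u₁ u₂ u₃ (λ v → W v × v ≢ w) → ⊥

    side₁ : Pair u₂ u₁ W
    side₁ = proj₁ arms
    side₃ : Pair u₂ u₃ W
    side₃ = proj₁ (proj₂ arms)
    cross : ∀ i j {v} → v ∈ walk side₁ i → v ∈ walk side₃ j → ⊥
    cross = proj₂ (proj₂ arms)

    pos : ∀ v → v ≢ u₁ → v ≢ u₂ → v ≢ u₃ → v ≢ u₄ → v ∈ M ⊎ W v
    pos v p q r s with v ∈? M
    ... | yes m = inj₁ m
    ... | no m  = inj₂ ((p , q , r , s) , m)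

  -- The configuration is symmetric in `u₁` and `u₃`. The contact of `u₃` with `M`, one half of the
  -- cut analysis and the second spoke move are mirror images obtained from this.
  swap-setting : Setting → Setting
  swap-setting S = record
    { u₁ = u₃ ; u₂ = u₂ ; u₃ = u₁ ; u₄ = u₄
    ; 1≢2 = 2≢3 ∘ sym ; 1≢3 = 1≢3 ∘ sym ; 1≢4 = 3≢4 ; 2≢3 = 1≢2 ∘ sym ; 2≢4 = 2≢4 ; 3≢4 = 1≢4
    ; noKite = noKite ∘ kite-swap flip
    ; M = M ; M-free = flip ∘ M-free ; M-conn = M-conn ; touch₄ = touch₄
    ; arms = swap-arms flipW arms
    ; maximal = λ w t a → maximal (flipW w) t (swap-arms (λ (p , q) → flipW p , q) a) }
    where
    open Setting S
    flip : ∀ {a b c d : Set} → a × b × c × d → c × b × a × d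
    flip (p , q , r , s) = r , q , p , s
    flipW : ∀ {a b c d e : Set} → (a × b × c × d) × e → (c × b × a × d) × e
    flipW (f , m) = flip f , m
    swap-arms : ∀ {a b c} {X Y : V → Set} → (∀ {v} → X v → Y v) → Arms a b c X → Arms c b a Y
    swap-arms f (p , q , cr) = pair-mono q (λ i → f ∘ inside q i) , pair-mono p (λ i → f ∘ inside p i) , λ i j m m′ → cr j i m′ m

  bool? : ∀ {P : Bool → Set} → (∀ i → Dec (P i)) → Dec (∃[ i ] P i)
  bool? P? with P? false | P? true
  ... | yes p | _ = yes (_ , p)
  ... | no _ | yes p = yes (_ , p)
  ... | no p | no q = no λ { (false , r) → p r ; (true , r) → q r }

  on? : ∀ {u v X} (p : Pair u v X) w → Dec (∃[ i ] w ∈ walk p i)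
  on? p w = bool? λ i → w ∈? walk p i

  second : Fin 2 → Bool
  second 0F = false
  second 1F = true

  pair-disjoint : ∀ {u v X} (p : Pair u v X) {i j w} → w ∈ walk p (second i) → w ∈ walk p (second j) → i ≡ j
  pair-disjoint p {0F} {0F} _ _ = refl
  pair-disjoint p {0F} {1F} m m′ = ⊥-elim (apart p false m m′)
  pair-disjoint p {1F} {0F} m m′ = ⊥-elim (apart p true m m′)
  pair-disjoint p {1F} {1F} _ _ = refl

  tip : V → V → Fin 4 → V
  tip u₁ u₃ 0F = u₁
  tip u₁ u₃ 1F = u₁
  tip u₁ u₃ 2F = u₃
  tip u₁ u₃ 3F = u₃

  module ArmIndex {u₁ u₂ u₃ X} (a : Arms u₁ u₂ u₃ X) where

    p = proj₁ a
    q = proj₁ (proj₂ a)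
    cr = proj₂ (proj₂ a)

    arm : Fin 4 → List V
    arm 0F = walk p false
    arm 1F = walk p true
    arm 2F = walk q false
    arm 3F = walk q true

    arm-disjoint : ∀ i j {v} → v ∈ arm i → v ∈ arm j → i ≡ j
    arm-disjoint 0F 0F _ _ = refl
    arm-disjoint 0F 1F m m′ = ⊥-elim (apart p false m m′)
    arm-disjoint 0F 2F m m′ = ⊥-elim (cr _ _ m m′)
    arm-disjoint 0F 3F m m′ = ⊥-elim (cr _ _ m m′)
    arm-disjoint 1F 0F m m′ = ⊥-elim (apart p true m m′)
    arm-disjoint 1F 1F _ _ = refl
    arm-disjoint 1F 2F m m′ = ⊥-elim (cr _ _ m m′)
    arm-disjoint 1F 3F m m′ = ⊥-elim (cr _ _ m m′)
    arm-disjoint 2F 0F m m′ = ⊥-elim (cr _ _ m′ m)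
    arm-disjoint 2F 1F m m′ = ⊥-elim (cr _ _ m′ m)
    arm-disjoint 2F 2F _ _ = refl
    arm-disjoint 2F 3F m m′ = ⊥-elim (apart q false m m′)
    arm-disjoint 3F 0F m m′ = ⊥-elim (cr _ _ m′ m)
    arm-disjoint 3F 1F m m′ = ⊥-elim (cr _ _ m′ m)
    arm-disjoint 3F 2F m m′ = ⊥-elim (apart q true m m′)
    arm-disjoint 3F 3F _ _ = refl

    arm-chain : ∀ i → ∃[ a ] ∃[ b ] (Chain _~_ a b (arm i) × u₂ ~ a × b ~ tip u₁ u₃ i)
    arm-chain 0F = _ , _ , chain p false , u~from p false , to~v p false
    arm-chain 1F = _ , _ , chain p true , u~from p true , to~v p true
    arm-chain 2F = _ , _ , chain q false , u~from q false , to~v q false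
    arm-chain 3F = _ , _ , chain q true , u~from q true , to~v q true

    arm-inside : ∀ i {v} → v ∈ arm i → X v
    arm-inside 0F = inside p false
    arm-inside 1F = inside p true
    arm-inside 2F = inside q false
    arm-inside 3F = inside q true

  -- Contacts of `M` with `u₂`, `u₁` and the arms

  module Contacts (σ : Setting) where
    open Setting σ public

    to-M : ∀ {u} L → length L < 8 → u ∉ L → (∀ {m} → m ∈ M → m ∉ L) → u ∉ M →
      ∃[ c ] (Conn (λ v → v ∉ M × v ∉ L) u c × Touch c)
    to-M L lt u∉ M∉ ∉M with touch₄
    ... | m , m∈ , _ with connected L lt u∉ (M∉ m∈)
    ...   | xs , c , _ , av with enter (_∈? M) c ∉M m∈
    ...     | c′ , d , cn , r , d∈ , _ = c′ , conn-mono (λ (p , q) → p , av q) cn , d , d∈ , ~-sym r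

    -- The path is simple, so after its first step it does not return to `u`. This matters because
    -- `W` excludes the roots and `u` will be one of them.
    to-M⁺ : ∀ {u} L → length L < 8 → u ∉ L → (∀ {m} → m ∈ M → m ∉ L) → u ∉ M →
      Touch u ⊎ ∃[ a ] ∃[ c ] (u ~ a × Conn (λ v → v ∉ M × v ∉ L × v ≢ u) a c × Touch c)
    to-M⁺ L lt u∉ M∉ ∉M with touch₄
    ... | m , m∈ , _ with connected L lt u∉ (M∉ m∈)
    ...   | _ , stop _ , _ = ⊥-elim (∉M m∈)
    ...   | _ , _∷_ {b = a} r c , px ∷ _ , av with a ∈? M
    ...     | yes a∈ = inj₁ (a , a∈ , ~-sym r)
    ...     | no a∉ with enter (_∈? M) c a∉ m∈
    ...       | c′ , d , cn , r′ , d∈ , _ = inj₂ (a , c′ , r ,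
                  conn-mono (λ (p , q) → p , av (there q) , All.lookup px q ∘ sym) cn , d , d∈ , ~-sym r′)

    u₁∉M : u₁ ∉ M
    u₁∉M m = proj₁ (M-free m) refl
    u₂∉M : u₂ ∉ M
    u₂∉M m = proj₁ (proj₂ (M-free m)) refl

    module FiveFan where

      Src Snk : Fin 5 → V → Set
      Src _ v = u₂ ~ v
      Snk 0F v = v ~ u₁
      Snk 1F v = v ~ u₁
      Snk 2F v = v ~ u₃
      Snk 3F v = v ~ u₃
      Snk 4F v = Touch v

      Snk? : ∀ j → Decidable (Snk j)
      Snk? 0F v = v ~? u₁
      Snk? 1F v = v ~? u₁
      Snk? 2F v = v ~? u₃
      Snk? 3F v = v ~? u₃
      Snk? 4F v = Touch? v

      open ArmIndex arms

      -- The last vertex of the fifth path touches `M`, and the other four paths are arms that avoid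
      -- it, so it could be added to `M`.
      routing-absurd : Routing W Src Snk → ⊥
      routing-absurd r = maximal (R.inside 4F end∈) (R.to-snk 4F)
        ( pair-mono pr (λ i m → inside pr i m , off (ix i) (ne i) m)
        , pair-mono qr (λ i m → inside qr i m , off (jx i) (ne′ i) m)
        , λ i j m m′ → ij i j (R.disjoint m m′))
        where
        module R = Routing r
        end∈ : R.to 4F ∈ R.path 4F
        end∈ = last∈ (R.chain 4F)
        ix jx : Bool → Fin 5
        ix false = 0F
        ix true  = 1F
        jx false = 2F
        jx true  = 3F
        ne : ∀ i → ix i ≢ 4F
        ne false ()
        ne true ()
        ne′ : ∀ i → jx i ≢ 4F
        ne′ false ()
        ne′ true ()
        ij : ∀ i j → ix i ≢ jx j
        ij false false ()
        ij false true ()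
        ij true false ()
        ij true true ()
        off : ∀ j → j ≢ 4F → ∀ {v} → v ∈ R.path j → v ≢ R.to 4F
        off j ne m refl = ne (R.disjoint m end∈)
        pr : Pair u₂ u₁ W
        pr = routing-pair r ix (λ { false () ; true () }) (λ i → R.from-src (ix i)) (λ { false → R.to-snk 0F ; true → R.to-snk 1F })
        qr : Pair u₂ u₃ W
        qr = routing-pair r jx (λ { false () ; true () }) (λ i → R.from-src (jx i)) (λ { false → R.to-snk 2F ; true → R.to-snk 3F })

      sink : ∀ i {b} → b ~ tip u₁ u₃ i → Snk (inject₁ i) b
      sink 0F r = r
      sink 1F r = r
      sink 2F r = r
      sink 3F r = r

      gated-arm : ∀ i → ∃[ a ] ∃[ b ] (Chain _~_ a b (arm i) × u₂ ~ a × Snk (inject₁ i) b)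
      gated-arm i = let a , b , c , r , r′ = arm-chain i in a , b , c , r , sink i r′

      module _ (c : Cut W Src Snk) where
        open Cut c
        open Crossing inject₁ inject₁ arm Fₚ.inject₁-injective Fₚ.inject₁-injective (arm-disjoint _ _)
          gated-arm arm-inside using (strict-bound)

        -- The four arms account for all of the at most four elements of the cut, so the gate of the
        -- fifth path is open. A path from `u₂` to `M` around the cut and the other roots then
        -- contradicts `blocks`.
        cut-absurd : ¬ Touch u₂ → ⊥
        cut-absurd ¬t with snk 4F ∈ᴺ? S
        ... | yes s = ℕₚ.<-irrefl refl (ℕₚ.≤-trans small (strict-bound s λ { 0F () ; 1F () ; 2F () ; 3F () }))
        ... | no s with to-M⁺ (u₁ ∷ u₃ ∷ u₄ ∷ verts S)
                     (ℕₚ.+-monoʳ-≤ 4 (ℕₚ.≤-trans (verts-length S) (ℕₚ.≤-pred small)))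
                     (λ { (here eq) → 1≢2 (sym eq) ; (there (here eq)) → 2≢3 eq ; (there (there (here eq))) → 2≢4 eq
                        ; (there (there (there m))) → proj₁ (proj₂ (proj₁ (within m))) refl })
                     (λ m → λ { (here refl) → proj₁ (M-free m) refl ; (there (here refl)) → proj₁ (proj₂ (proj₂ (M-free m))) refl
                        ; (there (there (here refl))) → proj₂ (proj₂ (proj₂ (M-free m))) refl
                        ; (there (there (there m′))) → proj₂ (within m′) m })
                     u₂∉M
        ...   | inj₁ t = ¬t t
        ...   | inj₂ (a , c′ , r , cn , t) = blocks (proj₂ free-source) s r t
                  (conn-mono (λ (p , q , w) → ((q ∘ here , w , q ∘ there ∘ here , q ∘ there ∘ there ∘ here) , p)
                                , q ∘ there ∘ there ∘ there) cn)

    touch₂ : Touch u₂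
    touch₂ with Touch? u₂
    ... | yes t = t
    ... | no ¬t with route W FiveFan.Src FiveFan.Snk W? (λ _ v → u₂ ~? v) FiveFan.Snk?
    ...   | inj₁ r = ⊥-elim (FiveFan.routing-absurd r)
    ...   | inj₂ c = ⊥-elim (FiveFan.cut-absurd c ¬t)

    through-M : ∀ {s t} → Touch s → Touch t → Link (_∈ M) s t
    through-M (m , m∈ , r) (m′ , m∈′ , r′) = m , m′ , ~-sym r , M-conn m∈ m∈′ , r′

    W-∉M : ∀ {v} → W v → v ∈ M → ⊥
    W-∉M = proj₂

    -- The components of `W` that contain a neighbour of `u₁`; `W₁-apart` shows that they miss the
    -- other side.
    W₁ : V → Set
    W₁ v = ∃[ a ] (u₁ ~ a × Conn W a v)

    W₁? : Decidable W₁
    W₁? v = Fₚ.any? (λ a → (u₁ ~? a) ×-dec conn? W? a v)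

    W₁⇒W : ∀ {v} → W₁ v → W v
    W₁⇒W (_ , _ , c) = conn-last c

    W₁-closed : ∀ {v w} → W₁ v → v ~ w → W w → W₁ w
    W₁-closed (a , r , c) r′ ww = a , r , conn-snoc c r′ ww

    side₁⊆W₁ : ∀ i {v} → v ∈ walk side₁ i → W₁ v
    side₁⊆W₁ i m = _ , ~-sym (to~v side₁ i) , conn-mono (inside side₁ i) (conn-sym (chain-from (chain side₁ i) m))

    -- The walk from u₁ to v, cut at its last visit to the first side, leaves one walk of that side unused
    Reached : V → Set₁
    Reached v = ∃[ i ] Σ (V → Set) λ R →
      (∀ {w} → R w → W w × w ∉ walk side₁ (not i) × (∀ j → w ∉ walk side₃ j)) × Att R u₁ v

    reached-absurd : ∀ {v j} → Reached v → v ∈ walk side₃ j → ⊥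
    reached-absurd {v} {j} (i , R , off , att) m = noKite (record
      { X₁ = _∈ walk side₁ (not i) ; X₃ = _∈ walk side₃ (not j) ; Xₘ = λ w → R w ⊎ w ∈ walk side₃ j ; Xₛ = _∈ M
      ; free₁ = proj₁ ∘ inside side₁ _ ; free₃ = proj₁ ∘ inside side₃ _
      ; freeₘ = [ proj₁ ∘ proj₁ ∘ off , proj₁ ∘ inside side₃ _ ]′ ; freeₛ = M-free
      ; d₁₃ = cross _ _ ; d₁ₘ = λ p → [ (λ r → proj₁ (proj₂ (off r)) p) , cross _ _ p ]′
      ; d₁ₛ = W-∉M ∘ inside side₁ _
      ; d₃ₘ = λ p → [ (λ r → proj₂ (proj₂ (off r)) _ p) , (λ q → apart side₃ j q p) ]′
      ; d₃ₛ = W-∉M ∘ inside side₃ _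
      ; dₘₛ = [ W-∉M ∘ proj₁ ∘ off , W-∉M ∘ inside side₃ _ ]′
      ; link₁ = link side₁ _ ; link₃ = link side₃ _
      ; linkₘ = att-link inj₁ inj₂ att (chain-from (chain side₃ j) m) (to~v side₃ j)
      ; linkₛ = through-M touch₂ touch₄ })

    unreached : ∀ {a b j xs} → Chain _~_ a b xs → (∀ {v} → v ∈ xs → W v) → Reached a → b ∈ walk side₃ j → ⊥
    unreached (stop _) inW re m = reached-absurd re m
    unreached {a} (r ∷ c) inW re m with on? side₃ a
    ... | yes (_ , m′) = reached-absurd re m′
    ... | no ¬3 with on? side₁ a
    ...   | yes (i , m′) = unreached c (inW ∘ there)
            (i , (_∈ walk side₁ i) , (λ q → inside side₁ i q , apart side₁ i q , λ j → cross i j q) , att-v side₁ i m′ r) m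
    ...   | no ¬1 with re
    ...     | i , R , off , att = unreached c (inW ∘ there)
              (i , (λ w → R w ⊎ w ≡ a) , [ off , (λ { refl → inW (here refl) , (λ q → ¬1 (_ , q)) , λ j q → ¬3 (_ , q) }) ]′
              , inj₂ (att-link inj₁ inj₂ att (conn-refl refl) r)) m

    W₁-apart : ∀ {v} j → W₁ v → v ∈ walk side₃ j → ⊥
    W₁-apart j (a , r , xs , c , inW) m = unreached c inW (true , (λ _ → ⊥) , (λ ()) , inj₁ r) m

    module ThreeFan where

      Snk : Fin 3 → V → Set
      Snk 0F v = v ~ u₂
      Snk 1F v = v ~ u₂
      Snk 2F v = Touch v

      Snk? : ∀ j → Decidable (Snk j)
      Snk? 0F v = v ~? u₂
      Snk? 1F v = v ~? u₂
      Snk? 2F v = Touch? v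

      -- The paths stay in `W₁` and thus off the other side, so two of them can replace the first
      -- side while the end of the third moves into `M`.
      routing-absurd : Routing W₁ (λ _ v → u₁ ~ v) Snk → ⊥
      routing-absurd r = maximal (W₁⇒W w₁) (R.to-snk 2F)
        ( pair-mono pr (λ { false m → W₁⇒W (inside pr false m) , off 0F (λ ()) (∈-reverse⁻ m)
                          ; true  m → W₁⇒W (inside pr true m) , off 1F (λ ()) (∈-reverse⁻ m) })
        , pair-mono side₃ (λ i m → inside side₃ i m , λ { refl → W₁-apart i w₁ m })
        , λ i j m m′ → W₁-apart j (inside pr i m) m′)
        where
        module R = Routing r
        w₁ : W₁ (R.to 2F)
        w₁ = R.inside 2F (last∈ (R.chain 2F))
        ix : Bool → Fin 3
        ix false = 0F
        ix true  = 1F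
        off : ∀ j → j ≢ 2F → ∀ {v} → v ∈ R.path j → v ≢ R.to 2F
        off j ne m refl = ne (R.disjoint m (last∈ (R.chain 2F)))
        pr : Pair u₂ u₁ W₁
        pr = pair-flip (routing-pair r ix (λ { false () ; true () }) (λ i → R.from-src (ix i))
               (λ { false → R.to-snk 0F ; true → R.to-snk 1F }))

      back : Pair u₁ u₂ W₁
      back = pair-flip (pair-mono side₁ side₁⊆W₁)

      sink : ∀ i {b} → b ~ u₂ → Snk (inject₁ i) b
      sink 0F r = r
      sink 1F r = r

      module _ (c : Cut W₁ (λ _ v → u₁ ~ v) Snk) where
        open Cut c
        open Crossing inject₁ inject₁ (walk back ∘ second) Fₚ.inject₁-injective Fₚ.inject₁-injective
          (pair-disjoint back)
          (λ i → _ , _ , chain back (second i) , u~from back (second i) , sink i (to~v back (second i)))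
          (λ i → inside back (second i)) using (strict-bound)

        cut-absurd : ¬ Touch u₁ → ⊥
        cut-absurd ¬t with snk 2F ∈ᴺ? S
        ... | yes s = ℕₚ.<-irrefl refl (ℕₚ.≤-trans small (strict-bound s λ { 0F () ; 1F () }))
        ... | no s with to-M⁺ (u₂ ∷ u₃ ∷ u₄ ∷ verts S)
                     (ℕₚ.≤-trans (ℕₚ.+-monoʳ-≤ 4 (ℕₚ.≤-trans (verts-length S) (ℕₚ.≤-pred small))) (ℕₚ.m≤n+m 6 2))
                     (λ { (here eq) → 1≢2 eq ; (there (here eq)) → 1≢3 eq ; (there (there (here eq))) → 1≢4 eq
                        ; (there (there (there m))) → proj₁ (proj₁ (W₁⇒W (within m))) refl })
                     (λ m → λ { (here refl) → u₂∉M m ; (there (here refl)) → proj₁ (proj₂ (proj₂ (M-free m))) refl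
                        ; (there (there (here refl))) → proj₂ (proj₂ (proj₂ (M-free m))) refl
                        ; (there (there (there m′))) → W-∉M (W₁⇒W (within m′)) m })
                     u₁∉M
        ...   | inj₁ t = ¬t t
        ...   | inj₂ (a , c′ , r , (xs , ch , inx) , t) = blocks (proj₂ free-source) s r t
                  (xs , ch , λ m → (a , r , conn-mono (clear ∘ inx) (chain-to ch m))
                                 , proj₁ (proj₂ (inx m)) ∘ there ∘ there ∘ there)
          where
          clear : ∀ {v} → v ∉ M × v ∉ (u₂ ∷ u₃ ∷ u₄ ∷ verts S) × v ≢ u₁ → W v
          clear (p , q , w) = (w , q ∘ here , q ∘ there ∘ here , q ∘ there ∘ there ∘ here) , p

    touch₁ : Touch u₁
    touch₁ with Touch? u₁
    ... | yes t = t
    ... | no ¬t with route W₁ (λ _ v → u₁ ~ v) ThreeFan.Snk W₁? (λ _ v → u₁ ~? v) ThreeFan.Snk?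
    ...   | inj₁ r = ⊥-elim (ThreeFan.routing-absurd r)
    ...   | inj₂ c = ⊥-elim (ThreeFan.cut-absurd c ¬t)

    OnArm : V → Set
    OnArm v = (∃[ i ] v ∈ walk side₁ i) ⊎ (∃[ j ] v ∈ walk side₃ j)

    OnArm? : Decidable OnArm
    OnArm? v = on? side₁ v ⊎-dec on? side₃ v

    -- Otherwise `w` could be added to `M` with the arms unchanged.
    touch-on-arm : ∀ {w} → W w → Touch w → OnArm w
    touch-on-arm {w} ww t with OnArm? w
    ... | yes o = o
    ... | no ¬o = ⊥-elim (maximal ww t
          ( pair-mono side₁ (λ i m → inside side₁ i m , λ { refl → ¬o (inj₁ (_ , m)) })
          , pair-mono side₃ (λ i m → inside side₃ i m , λ { refl → ¬o (inj₂ (_ , m)) }) , cross))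

  -- The neighbours of `u₄`

  module Neighbours (σ : Setting) where
    open Contacts σ public

    touch₃ : Touch u₃
    touch₃ = Contacts.touch₁ (swap-setting σ)

    Off : V → Set
    Off v = W v × ¬ OnArm v

    -- The path from `u₂` to `u₄` follows the arm to `d` and then the attachment. The other arm of
    -- that side, an arm of the other side and a path from `u₁` to `u₃` through `M` complete a kite.
    arm-u₄ : ∀ {d} → OnArm d → Att Off u₄ d → ⊥
    arm-u₄ {d} (inj₁ (i , m)) att = noKite (record
      { X₁ = _∈ walk side₁ (not i) ; X₃ = _∈ walk side₃ true ; Xₘ = _∈ M ; Xₛ = λ w → Off w ⊎ w ∈ walk side₁ i
      ; free₁ = proj₁ ∘ inside side₁ _ ; free₃ = proj₁ ∘ inside side₃ _ ; freeₘ = M-free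
      ; freeₛ = [ proj₁ ∘ proj₁ , proj₁ ∘ inside side₁ _ ]′
      ; d₁₃ = cross _ _ ; d₁ₘ = W-∉M ∘ inside side₁ _ ; d₃ₘ = W-∉M ∘ inside side₃ _
      ; d₁ₛ = λ p → [ (λ (_ , o) → o (inj₁ (_ , p))) , (λ q → apart side₁ i q p) ]′
      ; d₃ₛ = λ p → [ (λ (_ , o) → o (inj₂ (_ , p))) , (λ q → cross _ _ q p) ]′
      ; dₘₛ = λ p → [ (λ (w , _) → W-∉M w p) , (λ q → W-∉M (inside side₁ _ q) p) ]′
      ; link₁ = link side₁ _ ; link₃ = link side₃ _ ; linkₘ = through-M touch₁ touch₃
      ; linkₛ = link-sym (att-link inj₁ inj₂ att (conn-sym (chain-to (chain side₁ i) m)) (~-sym (u~from side₁ i))) })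
    arm-u₄ {d} (inj₂ (i , m)) att = noKite (record
      { X₁ = _∈ walk side₁ true ; X₃ = _∈ walk side₃ (not i) ; Xₘ = _∈ M ; Xₛ = λ w → Off w ⊎ w ∈ walk side₃ i
      ; free₁ = proj₁ ∘ inside side₁ _ ; free₃ = proj₁ ∘ inside side₃ _ ; freeₘ = M-free
      ; freeₛ = [ proj₁ ∘ proj₁ , proj₁ ∘ inside side₃ _ ]′
      ; d₁₃ = cross _ _ ; d₁ₘ = W-∉M ∘ inside side₁ _ ; d₃ₘ = W-∉M ∘ inside side₃ _
      ; d₁ₛ = λ p → [ (λ (_ , o) → o (inj₁ (_ , p))) , (λ q → cross _ _ p q) ]′
      ; d₃ₛ = λ p → [ (λ (_ , o) → o (inj₂ (_ , p))) , (λ q → apart side₃ i q p) ]′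
      ; dₘₛ = λ p → [ (λ (w , _) → W-∉M w p) , (λ q → W-∉M (inside side₃ _ q) p) ]′
      ; link₁ = link side₁ _ ; link₃ = link side₃ _ ; linkₘ = through-M touch₁ touch₃
      ; linkₛ = link-sym (att-link inj₁ inj₂ att (conn-sym (chain-to (chain side₃ i) m)) (~-sym (u~from side₃ i))) })

    clear : ∀ {v} → v ∉ M × v ∉ (u₁ ∷ u₂ ∷ u₃ ∷ u₄ ∷ []) → W v
    clear (p , q) = (q ∘ here , q ∘ there ∘ here , q ∘ there ∘ there ∘ here , q ∘ there ∘ there ∘ there ∘ here) , p

    -- If `w` is off the arms, it still reaches in `W` a vertex touching `M`, which is on an arm;
    -- the first arm vertex on the way is attached to `u₄`.
    u₄-outside : ∀ {w} → u₄ ~ w → W w → ⊥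
    u₄-outside {w} r ww@((p₁ , p₂ , p₃ , p₄) , w∉) with OnArm? w
    ... | yes o = arm-u₄ o (inj₁ r)
    ... | no ¬o with to-M (u₁ ∷ u₂ ∷ u₃ ∷ u₄ ∷ []) (ℕₚ.m≤n+m 5 3)
                 (λ { (here e) → p₁ e ; (there (here e)) → p₂ e ; (there (there (here e))) → p₃ e ; (there (there (there (here e)))) → p₄ e })
                 (λ m → let (q₁ , q₂ , q₃ , q₄) = M-free m in λ { (here e) → q₁ e ; (there (here e)) → q₂ e ; (there (there (here e))) → q₃ e ; (there (there (there (here e)))) → q₄ e })
                 w∉
    ...   | c , (xs , ch , inx) , t with enter OnArm? ch ¬o (touch-on-arm (clear (inx (last∈ ch))) t)
    ...     | c′ , d , cn , r′ , o , _ = arm-u₄ o (inj₂ (w , c′ , r , conn-mono (λ (p , q) → clear (inx q) , p) cn , r′))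

    u₄-neighbour : ∀ S → length S < 5 → u₄ ∉ S → ∃[ m ] (m ∈ M × u₄ ~ m × m ∉ S)
    u₄-neighbour S lt u₄∉ with neighbour u₄ (u₁ ∷ u₂ ∷ u₃ ∷ S) (s≤s (s≤s (s≤s lt)))
           (λ { (here e) → 1≢4 (sym e) ; (there (here e)) → 2≢4 (sym e) ; (there (there (here e))) → 3≢4 (sym e)
              ; (there (there (there m))) → u₄∉ m })
    ... | v , r , v∉ with pos v (v∉ ∘ here) (v∉ ∘ there ∘ here) (v∉ ∘ there ∘ there ∘ here) (λ { refl → ~-irrefl r })
    ...   | inj₁ m = v , m , r , v∉ ∘ there ∘ there ∘ there
    ...   | inj₂ w = ⊥-elim (u₄-outside r w)

  -- The ring through `u₄` and cut vertices of `M`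

  outside : ∀ {T S : List V} → Unique T → length S < length T → ∃[ t ] (t ∈ T × t ∉ S)
  outside {T} {S} u lt with Fₚ.any? (λ i → ¬? (lookup T i ∈? S))
  ... | yes (i , i∉) = _ , ∈-lookup i , i∉
  ... | no none = ⊥-elim (ℕₚ.<-irrefl refl (ℕₚ.≤-trans lt (injection-length (lookup T) S (Unique-lookup u)
          λ i → decidable-stable (lookup T i ∈? S) λ i∉ → none (i , i∉))))

  conn-each : ∀ {X a b} ((xs , _) : Conn X a b) → ∀ {v} → v ∈ xs → Conn X a v
  conn-each (xs , c , inx) m = conn-mono inx (chain-to c m)

  -- A cycle cut open at `u₄`, which turns cyclic order relative to `u₄` into linear order along
  -- `T`. Three vertices in `T` are needed for three disjoint paths to start there.
  record Ring (M : List V) (u₄ : V) : Set where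
    field
      T        : List V
      t₁ t₂    : V
      T-chain  : Chain _~_ t₁ t₂ T
      T-unique : Unique T
      T⊆M      : ∀ {v} → v ∈ T → v ∈ M
      t₁~u₄    : t₁ ~ u₄
      t₂~u₄    : t₂ ~ u₄
      3≤T      : 3 ≤ length T

    -- `z` lies on at most one side of `t`, so in the other direction `T` leads to an end, next to
    -- `u₄`.
    exit : ∀ {t z} → t ∈ T → t ≢ z → ∃[ e ] (Conn (λ v → v ∈ T × v ≢ z) t e × e ~ u₄)
    exit {t} {z} t∈ t≢z with split-at T-chain T-unique t∈
    ... | sp with z ∈? SplitAt.before sp
    ...   | yes z∈ = t₂ , (_ , from-t , λ { (here refl) → t∈ , t≢z
                                         ; (there m) → after⊆ m , λ { refl → separated z∈ m } }) , t₂~u₄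
      where open SplitAt sp
    ...   | no z∉ = t₁ , conn-sym (_ , to-t , λ m → [ (λ l → before⊆ l , λ { refl → z∉ l })
                        , (λ { (here refl) → t∈ , t≢z }) ]′ (∈-++⁻ before m)) , t₁~u₄
      where open SplitAt sp

  module Contact (σ : Setting) where
    open Neighbours σ public

    Contact₁ Contact₃ : V → Set
    Contact₁ x = u₁ ~ x ⊎ ∃[ i ] ∃[ c ] (c ∈ walk side₁ i × c ~ x)
    Contact₃ x = u₃ ~ x ⊎ ∃[ i ] ∃[ c ] (c ∈ walk side₃ i × c ~ x)

    Contact₁? : Decidable Contact₁
    Contact₁? x = (u₁ ~? x) ⊎-dec bool? (λ i → Fₚ.any? (λ c → (c ∈? walk side₁ i) ×-dec (c ~? x)))

    Contact₃? : Decidable Contact₃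
    Contact₃? x = (u₃ ~? x) ⊎-dec bool? (λ i → Fₚ.any? (λ c → (c ∈? walk side₃ i) ×-dec (c ~? x)))

    contact₁-att : ∀ {x} → Contact₁ x → ∃[ i ] Att (_∈ walk side₁ i) u₁ x
    contact₁-att (inj₁ r) = true , inj₁ r
    contact₁-att (inj₂ (i , c , c∈ , r)) = i , att-v side₁ i c∈ r

    contact₃-att : ∀ {x} → Contact₃ x → ∃[ i ] Att (_∈ walk side₃ i) u₃ x
    contact₃-att (inj₁ r) = true , inj₁ r
    contact₃-att (inj₂ (i , c , c∈ , r)) = i , att-v side₃ i c∈ r

    -- A vertex of M which separates T from u₂ and from the third side would cut off a
    -- part Y of M; routing {u₁, u₁, Y} to {u₂, u₂, M ∖ Y} outside M refutes this.
    module CutVertex (ring : Ring M u₄) {z : V} (z∈M : z ∈ M) where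
      open Ring ring

      Mz : V → Set
      Mz v = v ∈ M × v ≢ z

      module _ (hidden : ∀ {t m} → t ∈ T → t ≢ z → Conn Mz t m → ¬ (m ~ u₂) × ¬ Contact₃ m) where

        -- `Y` is what stays attached to the ring when `z` is deleted; the ring joins it to `u₄`.
        -- `O` is the rest of `M`, which contains `z` and is connected through it.
        Y O YT OT : V → Set
        Y v = ∃[ t ] ((t ∈ T × t ≢ z) × Conn Mz t v)
        O v = v ∈ M × ¬ Y v
        YT v = ∃[ y ] (Y y × y ~ v)
        OT v = ∃[ o ] (O o × o ~ v)

        Y? : Decidable Y
        Y? v = Fₚ.any? (λ t → ((t ∈? T) ×-dec ¬? (t Fₚ.≟ z)) ×-dec conn? (λ w → (w ∈? M) ×-dec ¬? (w Fₚ.≟ z)) t v)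
        O? : Decidable O
        O? v = (v ∈? M) ×-dec ¬? (Y? v)
        YT? : Decidable YT
        YT? v = Fₚ.any? (λ y → Y? y ×-dec (y ~? v))
        OT? : Decidable OT
        OT? v = Fₚ.any? (λ y → O? y ×-dec (y ~? v))

        Y⊆M : ∀ {v} → Y v → v ∈ M
        Y⊆M (_ , _ , c) = proj₁ (conn-last c)

        Y-exit : ∀ {y} → Y y → ∃[ e ] (Conn Y y e × e ~ u₄)
        Y-exit (t , (t∈ , t≢) , c@(_ , ch , _)) with exit t∈ t≢
        ... | e , c′ , r = e , conn-trans (conn-sym (_ , ch , λ m → t , (t∈ , t≢) , conn-each c m))
                              (conn-mono (λ (m , ne) → _ , (m , ne) , conn-refl (T⊆M m , ne)) c′) , r

        z∈O : O z
        z∈O = z∈M , λ (_ , _ , c) → proj₂ (conn-last c) refl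

        O-to-z : ∀ {a} → O a → Conn O a z
        O-to-z {a} (a∈ , ¬y) with a Fₚ.≟ z
        ... | yes refl = conn-refl z∈O
        ... | no a≢z with M-conn a∈ z∈M
        ...   | xs , c , inM with enter (Fₚ._≟ z) c a≢z refl
        ...     | c′ , _ , cn@(_ , ch , inx) , r , refl , _ = conn-snoc {X = O} (_ , ch , λ m → inM (proj₂ (inx m)) ,
                    λ (t , t∈ , d) → ¬y (t , t∈ , conn-trans d
                      (conn-sym (conn-mono (λ (ne , m′) → inM m′ , ne) (conn-each cn m))))) r z∈O

        O-conn : ∀ {a b} → O a → O b → Conn O a b
        O-conn p q = conn-trans (O-to-z p) (conn-sym (O-to-z q))

        Src Snk : Fin 3 → V → Set
        Src 0F v = u₁ ~ v
        Src 1F v = u₁ ~ v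
        Src 2F v = YT v
        Snk 0F v = v ~ u₂
        Snk 1F v = v ~ u₂
        Snk 2F v = OT v

        Src? : ∀ j → Decidable (Src j)
        Src? 0F v = u₁ ~? v
        Src? 1F v = u₁ ~? v
        Src? 2F v = YT? v
        Snk? : ∀ j → Decidable (Snk j)
        Snk? 0F v = v ~? u₂
        Snk? 1F v = v ~? u₂
        Snk? 2F v = OT? v

        module Routed (r : Routing W₁ Src Snk) where
          module R = Routing r

          from-u₁ : ∀ j → R.origin j ≢ 2F → u₁ ~ R.from j
          from-u₁ j ne with R.origin j | R.from-src j
          ... | 0F | s = s
          ... | 1F | s = s
          ... | 2F | _ = ⊥-elim (ne refl)

          from-Y : ∀ j → R.origin j ≡ 2F → YT (R.from j)
          from-Y j eq = subst (λ i → Src i (R.from j)) eq (R.from-src j)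

          other : ∀ {i j} → R.origin i ≡ 2F → j ≢ i → R.origin j ≢ 2F
          other eq ne eq′ = ne (R.origin-inj (trans eq′ (sym eq)))

          -- The path from `Y` to `O` is spare, since the other two join `u₁` to `u₂`; its first
          -- vertex touches `Y` and could be added to `M`.
          grow : R.origin 2F ≡ 2F → ⊥
          grow eq = maximal (W₁⇒W w₁) touched
            ( pair-mono pr (λ { false m → W₁⇒W (inside pr false m) , off 0F (λ ()) (∈-reverse⁻ m)
                              ; true  m → W₁⇒W (inside pr true m) , off 1F (λ ()) (∈-reverse⁻ m) })
            , pair-mono side₃ (λ i m → inside side₃ i m , λ { refl → W₁-apart i w₁ m })
            , λ i j m m′ → W₁-apart j (inside pr i m) m′)
            where
            w₁ : W₁ (R.from 2F)
            w₁ = R.inside 2F (head∈ (R.chain 2F))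
            touched : Touch (R.from 2F)
            touched = let y , yy , r = from-Y 2F eq in y , Y⊆M yy , r
            ix : Bool → Fin 3
            ix false = 0F
            ix true  = 1F
            off : ∀ j → j ≢ 2F → ∀ {v} → v ∈ R.path j → v ≢ R.from 2F
            off j ne m refl = ne (R.disjoint m (head∈ (R.chain 2F)))
            pr : Pair u₂ u₁ W₁
            pr = pair-flip (routing-pair r ix (λ { false () ; true () })
                   (λ { false → from-u₁ 0F (other eq λ ()) ; true → from-u₁ 1F (other eq λ ()) })
                   (λ { false → R.to-snk 0F ; true → R.to-snk 1F }))

          -- Path `j` read backwards leads from `u₂` into `Y` and on to `u₄`. Path `2F` leads from
          -- `u₁` into `O`, which contains a neighbour of `u₃` because `Y` has none. Path `k` and a
          -- walk of the other side supply the rest.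
          kite : ∀ j k → j ≢ k → j ≢ 2F → k ≢ 2F → R.to j ~ u₂ → R.to k ~ u₂ → R.origin j ≡ 2F → ⊥
          kite j k jk j2 k2 tj tk eq with from-Y j eq | R.to-snk 2F | touch₃
          ... | y , yy , ry | o , oo , ro | m₃ , m₃∈ , r₃ with Y-exit yy
          ...   | e , cy , re = noKite (record
            { X₁ = _∈ R.path k ; X₃ = _∈ walk side₃ true
            ; Xₘ = λ v → v ∈ R.path 2F ⊎ O v ; Xₛ = λ v → v ∈ R.path j ⊎ Y v
            ; free₁ = free k ; free₃ = proj₁ ∘ inside side₃ _
            ; freeₘ = [ free 2F , M-free ∘ proj₁ ]′ ; freeₛ = [ free j , M-free ∘ Y⊆M ]′
            ; d₁₃ = λ p → W₁-apart _ (R.inside k p)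
            ; d₁ₘ = λ p → [ (λ q → k2 (R.disjoint p q)) , W-∉M (in-W k p) ∘ proj₁ ]′
            ; d₁ₛ = λ p → [ (λ q → jk (R.disjoint q p)) , W-∉M (in-W k p) ∘ Y⊆M ]′
            ; d₃ₘ = λ p → [ (λ q → W₁-apart _ (R.inside 2F q) p) , W-∉M (inside side₃ _ p) ∘ proj₁ ]′
            ; d₃ₛ = λ p → [ (λ q → W₁-apart _ (R.inside j q) p) , W-∉M (inside side₃ _ p) ∘ Y⊆M ]′
            ; dₘₛ = λ { (inj₁ p) (inj₁ q) → j2 (R.disjoint q p) ; (inj₁ p) (inj₂ q) → W-∉M (in-W 2F p) (Y⊆M q)
                      ; (inj₂ p) (inj₁ q) → W-∉M (in-W j q) (proj₁ p) ; (inj₂ p) (inj₂ q) → proj₂ p q }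
            ; link₁ = link-sym (_ , _ , from-u₁ k (other eq (jk ∘ sym)) , (_ , R.chain k , id) , tk)
            ; link₃ = link side₃ true
            ; linkₘ = att-link inj₁ inj₂ (inj₂ (_ , _ , from-u₁ 2F (other eq (j2 ∘ sym)) , (_ , R.chain 2F , id) , ~-sym ro))
                        (O-conn oo (m₃∈ , λ (t , (t∈ , t≢) , c) → proj₂ (hidden t∈ t≢ c) (inj₁ (~-sym r₃)))) r₃
            ; linkₛ = att-link inj₁ inj₂ (inj₂ (_ , _ , ~-sym tj , conn-sym (_ , R.chain j , id) , ~-sym ry)) cy re })
            where
            in-W : ∀ j {v} → v ∈ R.path j → W v
            in-W j = W₁⇒W ∘ R.inside j
            free : ∀ j {v} → v ∈ R.path j → Free v
            free j = proj₁ ∘ in-W j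

          absurd : ⊥
          absurd with R.origin 0F Fₚ.≟ 2F | R.origin 1F Fₚ.≟ 2F | R.origin 2F Fₚ.≟ 2F
          ... | yes e | _ | _ = kite 0F 1F (λ ()) (λ ()) (λ ()) (R.to-snk 0F) (R.to-snk 1F) e
          ... | no _ | yes e | _ = kite 1F 0F (λ ()) (λ ()) (λ ()) (R.to-snk 1F) (R.to-snk 0F) e
          ... | no _ | no _ | yes e = grow e
          ... | no p | no q | no s = ℕₚ.<-irrefl refl (injection-length R.origin (0F ∷ 1F ∷ []) R.origin-inj
                  λ { 0F → low _ p ; 1F → low _ q ; 2F → low _ s })
            where
            low : ∀ (i : Fin 3) → i ≢ 2F → i ∈ (0F ∷ 1F ∷ [])
            low 0F _ = here refl
            low 1F _ = there (here refl)
            low 2F ne = ⊥-elim (ne refl)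

        source : ∀ i {b} → u₁ ~ b → Src (inject₁ i) b
        source 0F r = r
        source 1F r = r

        sink : ∀ i {b} → b ~ u₂ → Snk (inject₁ i) b
        sink 0F r = r
        sink 1F r = r

        back : Pair u₁ u₂ W₁
        back = pair-flip (pair-mono side₁ side₁⊆W₁)

        module Separated (c : Cut W₁ Src Snk) where
          open Cut c
          open Crossing inject₁ inject₁ (walk back ∘ second) Fₚ.inject₁-injective Fₚ.inject₁-injective
            (pair-disjoint back)
            (λ i → _ , _ , chain back (second i) , source i (u~from back (second i)) , sink i (to~v back (second i)))
            (λ i → inside back (second i)) using (strict-bound)

          Y-free : src 2F ∉ S
          Y-free s = ℕₚ.<-irrefl refl (ℕₚ.≤-trans small (strict-bound s λ { 0F () ; 1F () }))

          O-free : snk 2F ∉ S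
          O-free s = ℕₚ.<-irrefl refl (ℕₚ.≤-trans small (strict-bound s λ { 0F () ; 1F () }))

          -- The invariant along a walk that avoids `z`, the roots and the cut: it is in `Y`, or it
          -- has stayed in `W₁` since it last left `Y`.
          State : V → Set
          State v = Y v ⊎ ∃[ w ] (YT w × Conn (λ v → W₁ v × v ∉ verts S) w v)

          L : List V
          L = z ∷ u₁ ∷ u₂ ∷ u₃ ∷ u₄ ∷ verts S

          -- A step from `Y` into `W` lands on an arm, and on the first side because `Y` has no
          -- contact with the other. A step from `W₁` into `O` would complete a route from `Y` to
          -- `O` around the cut. So the walk never reaches the other side.
          run-Y : ∀ {a b xs} → Chain _~_ a b xs → (∀ {v} → v ∈ xs → v ∉ L) → State a → W b → ¬ W₁ b → ⊥
          run-Y (stop _) av (inj₁ y) w ¬w₁ = W-∉M w (Y⊆M y)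
          run-Y (stop _) av (inj₂ (_ , _ , cn)) w ¬w₁ = ¬w₁ (proj₁ (conn-last cn))
          run-Y {a} (_∷_ {b = a′} r c) av st w ¬w₁ with av (there (head∈ c))
          ... | a′∉ with pos a′ (a′∉ ∘ there ∘ here) (a′∉ ∘ there ∘ there ∘ here) (a′∉ ∘ there ∘ there ∘ there ∘ here)
                           (a′∉ ∘ there ∘ there ∘ there ∘ there ∘ here) | st
          ...   | inj₁ m | inj₁ (t , t∈ , cn) = run-Y c (av ∘ there) (inj₁ (t , t∈ , conn-snoc cn r (m , a′∉ ∘ here))) w ¬w₁
          ...   | inj₂ ww | inj₂ (w₀ , t , cn) = run-Y c (av ∘ there) (inj₂ (w₀ , t ,
                    conn-snoc cn r (W₁-closed (proj₁ (conn-last cn)) r ww , a′∉ ∘ there ∘ there ∘ there ∘ there ∘ there))) w ¬w₁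
          ...   | inj₂ ww | inj₁ y@(t , (t∈ , t≢) , cn) with touch-on-arm ww (a , Y⊆M y , r)
          ...     | inj₁ (i , m) = run-Y c (av ∘ there) (inj₂ (a′ , (a , y , r) ,
                      conn-refl (side₁⊆W₁ i m , a′∉ ∘ there ∘ there ∘ there ∘ there ∘ there))) w ¬w₁
          ...     | inj₂ (i , m) = proj₂ (hidden t∈ t≢ cn) (inj₂ (i , a′ , m , ~-sym r))
          run-Y {a} (_∷_ {b = a′} r c) av st w ¬w₁ | a′∉ | inj₁ m | inj₂ (w₀ , t , cn) with Y? a′
          ...     | yes y = run-Y c (av ∘ there) (inj₁ y) w ¬w₁
          ...     | no ¬y = blocks Y-free O-free t (a′ , (m , ¬y) , ~-sym r) cn

          absurd : ⊥
          absurd with outside {S = z ∷ []} T-unique (ℕₚ.≤-trans (ℕₚ.m≤n+m 2 1) 3≤T)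
          ... | t , t∈ , t∉ with connected L
                 (ℕₚ.+-monoʳ-≤ 6 (ℕₚ.≤-trans (verts-length S) (ℕₚ.≤-pred small)))
                 (λ { (here e) → t∉ (here e) ; (there m) → avoid-M (T⊆M t∈) m })
                 (λ { (here refl) → W-∉M b∈ z∈M ; (there m) → avoid-b m })
            where
            b∈ : W (from side₃ true)
            b∈ = inside side₃ true (head∈ (chain side₃ true))
            avoid-M : ∀ {m} → m ∈ M → m ∉ (u₁ ∷ u₂ ∷ u₃ ∷ u₄ ∷ verts S)
            avoid-M m = let (q₁ , q₂ , q₃ , q₄) = M-free m in λ
              { (here e) → q₁ e ; (there (here e)) → q₂ e ; (there (there (here e))) → q₃ e
              ; (there (there (there (here e)))) → q₄ e
              ; (there (there (there (there s)))) → W-∉M (W₁⇒W (within s)) m }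
            avoid-b : from side₃ true ∉ (u₁ ∷ u₂ ∷ u₃ ∷ u₄ ∷ verts S)
            avoid-b = let ((q₁ , q₂ , q₃ , q₄) , _) = b∈ in λ
              { (here e) → q₁ e ; (there (here e)) → q₂ e ; (there (there (here e))) → q₃ e
              ; (there (there (there (here e)))) → q₄ e
              ; (there (there (there (there s)))) → W₁-apart true (within s) (head∈ (chain side₃ true)) }
          ...   | xs , c , _ , av = run-Y c av (inj₁ (t , (t∈ , λ { refl → t∉ (here refl) }) ,
                     conn-refl (T⊆M t∈ , λ { refl → t∉ (here refl) })))
                     (inside side₃ true (head∈ (chain side₃ true)))
                     (λ w₁ → W₁-apart true w₁ (head∈ (chain side₃ true)))

        cut-vertex-absurd : ⊥
        cut-vertex-absurd with route W₁ Src Snk W₁? Src? Snk?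
        ... | inj₁ r = Routed.absurd r
        ... | inj₂ c = Separated.absurd c

  -- Three disjoint spokes from the ring

  module Enclosed (σ : Setting) (ring : Ring (Setting.M σ) (Setting.u₄ σ)) where
    open Contact σ public
    open Ring ring public

    T-start : t₁ ∈ T
    T-start = head∈ T-chain

    module _ {Snk : Fin 3 → V → Set} (c : Cut (_∈ M) (λ _ v → v ∈ T) Snk) where
      open Cut c

      few : 3 ≤ length S → ⊥
      few le = ℕₚ.<-irrefl refl (ℕₚ.≤-trans small le)

      -- Besides `snk p` the cut has room for one element. If the cut contains no vertex, one of the
      -- other gates is open and is reached because `M` is connected; if it contains a vertex `z`,
      -- then `z` separates the ring from both. The gates are parameters so that the mirrored
      -- setting can treat the same cut.
      one-sided : ∀ {p q : Fin 3} → p ≢ 1F → q ≢ 1F → p ≢ q → (∀ {v} → v ~ u₂ → Snk 1F v) →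
        (∀ {v} → Contact₃ v → Snk q v) → snk p ∈ S → ⊥
      one-sided {p} {q} p1 q1 pq S₂ S₃ p∈ with Fₚ.any? (λ v → v ∈? verts S)
      ... | no none with snk 1F ∈ᴺ? S | snk q ∈ᴺ? S
      ...   | no s | _ = let m , m∈ , r = touch₂ in
              blocks (proj₂ free-source) s T-start (S₂ r) (conn-mono (λ v∈ → v∈ , λ v∈S → none (_ , v∈S)) (M-conn (T⊆M T-start) m∈))
      ...   | yes _ | no s = let m , m∈ , r = touch₃ in
              blocks (proj₂ free-source) s T-start (S₃ (inj₁ (~-sym r))) (conn-mono (λ v∈ → v∈ , λ v∈S → none (_ , v∈S)) (M-conn (T⊆M T-start) m∈))
      ...   | yes s | yes s′ = few (three-≤ p∈ s s′ (λ { refl → p1 refl }) (λ { refl → pq refl }) (λ { refl → q1 refl }))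
      one-sided {p} {q} p1 q1 pq S₂ S₃ p∈ | yes (z , z∈) = CutVertex.cut-vertex-absurd ring (within z∈)
        λ t∈ t≢z cn → (λ r → blocks (proj₂ free-source) 1∉ t∈ (S₂ r) (mono cn))
                    , (λ r → blocks (proj₂ free-source) q∉ t∈ (S₃ r) (mono cn))
        where
        1∉ : snk 1F ∉ S
        1∉ s = few (three-≤ p∈ s (verts⁻ z∈) (λ { refl → p1 refl }) (λ ()) (λ ()))
        q∉ : snk q ∉ S
        q∉ s = few (three-≤ p∈ s (verts⁻ z∈) (λ { refl → pq refl }) (λ ()) (λ ()))
        mono : ∀ {a b} → Conn (λ v → v ∈ M × v ≢ z) a b → Conn (λ v → v ∈ M × v ∉ verts S) a b
        mono = conn-mono λ (m , ne) → m , λ v∈ →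
          few (three-≤ p∈ (verts⁻ v∈) (verts⁻ z∈) (λ ()) (λ ()) (λ { refl → ne refl }))

  module Linking (σ : Setting) (ring : Ring (Setting.M σ) (Setting.u₄ σ)) where
    open Enclosed σ ring public

    Goal : Fin 3 → V → Set
    Goal 0F v = Contact₁ v
    Goal 1F v = v ~ u₂
    Goal 2F v = Contact₃ v

    Goal? : ∀ i → Decidable (Goal i)
    Goal? 0F = Contact₁?
    Goal? 1F v = v ~? u₂
    Goal? 2F = Contact₃?

    contact : ∀ {m d} → m ∈ M → m ~ d → d ∉ M → d ≢ u₂ → d ≢ u₄ → Contact₁ m ⊎ Contact₃ m
    contact {m} {d} m∈ r d∉ d2 d4 with d Fₚ.≟ u₁ | d Fₚ.≟ u₃
    ... | yes refl | _ = inj₁ (inj₁ (~-sym r))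
    ... | no _ | yes refl = inj₂ (inj₁ (~-sym r))
    ... | no d1 | no d3 with touch-on-arm ((d1 , d2 , d3 , d4) , d∉) (m , m∈ , r)
    ...   | inj₁ (i , o) = inj₁ (inj₂ (i , d , o , ~-sym r))
    ...   | inj₂ (i , o) = inj₂ (inj₂ (i , d , o , ~-sym r))

    -- When both side gates are open, a ring vertex outside the cut is joined to `u₁` around `u₂`,
    -- `u₄` and the cut. Where this path first leaves `M` it stands next to one of the two sides,
    -- through an open gate.
    cut-absurd : Cut (_∈ M) (λ _ v → v ∈ T) Goal → ⊥
    cut-absurd c with snk 0F ∈ᴺ? Cut.S c | snk 2F ∈ᴺ? Cut.S c
    ... | yes s | _ = one-sided c {0F} {2F} (λ ()) (λ ()) (λ ()) id id s
    ... | no _ | yes s = Enclosed.one-sided (swap-setting σ) ring c {2F} {0F} (λ ()) (λ ()) (λ ()) id id s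
    ... | no s | no s′ with outside {S = verts (Cut.S c)} T-unique (ℕₚ.≤-trans (s≤s (ℕₚ.≤-trans (verts-length (Cut.S c)) (ℕₚ.≤-pred (Cut.small c)))) 3≤T)
    ...   | t , t∈ , t∉ with connected (u₄ ∷ u₂ ∷ verts (Cut.S c))
               (ℕₚ.≤-trans (ℕₚ.+-monoʳ-≤ 3 (ℕₚ.≤-trans (verts-length (Cut.S c)) (ℕₚ.≤-pred (Cut.small c)))) (ℕₚ.m≤n+m 5 3))
               {t} {u₁}
               (λ { (here e) → proj₂ (proj₂ (proj₂ (M-free (T⊆M t∈)))) e ; (there (here e)) → proj₁ (proj₂ (M-free (T⊆M t∈))) e
                  ; (there (there m)) → t∉ m })
               (λ { (here e) → 1≢4 e ; (there (here e)) → 1≢2 e ; (there (there m)) → u₁∉M (Cut.within c m) })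
    ...     | xs , ch , _ , av with enter (λ v → ¬? (v ∈? M)) ch (λ t∉M → t∉M (T⊆M t∈)) u₁∉M
    ...       | m , d , cn , r , d∉ , d∈ with contact m∈ r d∉ (λ { refl → av d∈ (there (here refl)) }) (λ { refl → av d∈ (here refl) })
      where
      m∈ : m ∈ M
      m∈ = decidable-stable (m ∈? M) (proj₁ (conn-last cn))
    ...         | inj₁ k = Cut.blocks c (proj₂ (Cut.free-source c)) s t∈ k
                    (conn-mono (λ (p , q) → decidable-stable (_ ∈? M) p , av q ∘ there ∘ there) cn)
    ...         | inj₂ k = Cut.blocks c (proj₂ (Cut.free-source c)) s′ t∈ k
                    (conn-mono (λ (p , q) → decidable-stable (_ ∈? M) p , av q ∘ there ∘ there) cn)

    record Spokes : Set where
      field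
        P     : Fin 3 → List V
        v x   : Fin 3 → V
        spoke : ∀ i → Chain _~_ (v i) (x i) (P i)
        v∈T   : ∀ i → v i ∈ T
        P⊆M   : ∀ i {w} → w ∈ P i → w ∈ M
        only  : ∀ i {w} → w ∈ P i → w ∈ T → w ≡ v i
        apart-P : ∀ {i j w} → w ∈ P i → w ∈ P j → i ≡ j
        goal  : ∀ i → Goal i (x i)

      v∈P : ∀ i → v i ∈ P i
      v∈P i = head∈ (spoke i)

    spokes : Spokes
    spokes with route (_∈ M) (λ _ v → v ∈ T) Goal (_∈? M) (λ _ v → v ∈? T) Goal?
    ... | inj₂ c = ⊥-elim (cut-absurd c)
    ... | inj₁ r = record
      { P = λ i → proj₁ (proj₂ (D i)) ; v = λ i → proj₁ (D i) ; x = R.to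
      ; spoke = λ i → proj₁ (proj₂ (proj₂ (D i)))
      ; v∈T = λ i → proj₁ (proj₂ (proj₂ (proj₂ (D i))))
      ; P⊆M = λ i → R.inside i ∘ sub i
      ; only = λ i m t → [ id , (λ (¬t , _) → ⊥-elim (¬t t)) ]′ (proj₂ (proj₂ (proj₂ (proj₂ (proj₂ (D i))))) m)
      ; apart-P = λ {i} {j} m m′ → R.disjoint (sub i m) (sub j m′)
      ; goal = R.to-snk }
      where
      module R = Routing r
      D : ∀ i → ∃[ c ] ∃[ ys ] (Chain _~_ c (R.to i) ys × c ∈ T × (∀ {v} → v ∈ ys → v ∈ R.path i) ×
        (∀ {v} → v ∈ ys → v ≡ c ⊎ (v ∉ T × ∃[ zs ] (Chain _~_ v (R.to i) zs × ∀ {w} → w ∈ zs → w ∉ T))))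
      -- Each path is cut at its last visit to `T`, so that a spoke meets the ring in its first
      -- vertex only.
      D i with last-hit (_∈? T) (R.chain i)
      ... | inj₁ av = ⊥-elim (av (head∈ (R.chain i)) (R.from-src i))
      ... | inj₂ d = d
      sub : ∀ i {v} → v ∈ proj₁ (proj₂ (D i)) → v ∈ R.path i
      sub i = proj₁ (proj₂ (proj₂ (proj₂ (proj₂ (D i)))))

    conn-att : ∀ {D R Z : V → Set} → (∀ {w} → D w → Z w) → (∀ {w} → R w → Z w) →
      ∀ {a b u} → Conn D a b → Att R u b → ∃[ e ] (Conn Z a e × e ~ u)
    conn-att f g c (inj₁ r) = _ , conn-mono f c , ~-sym r
    conn-att f g c (inj₂ (a , b , r , d , r′)) =
      a , conn-append (conn-mono f c) (~-sym r′) (conn-sym (conn-mono g d)) , ~-sym r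

    -- In the first kite the walk of side₁ that is not used by the triangle carries the u₁–u₃ path,
    -- in the second one it carries the u₂–u₄ path.
    kite-straight : ∀ {i j x y} {D E : V → Set} → (∀ {w} → D w → w ∈ M) → (∀ {w} → E w → w ∈ M) →
      (∀ {w} → D w → E w → ⊥) → Att (_∈ walk side₁ i) u₁ x → Conn D x y → Att (_∈ walk side₃ j) u₃ y →
      Link E u₂ u₄ → ⊥
    kite-straight {i} {j} {D = D} {E} D⊆ E⊆ dis a₁ c a₃ l with conn-att {Z = λ w → D w ⊎ w ∈ walk side₃ j} inj₁ inj₂ c a₃
    ... | e , c′ , r = noKite (record
      { X₁ = _∈ walk side₁ (not i) ; X₃ = _∈ walk side₃ (not j)
      ; Xₘ = λ w → w ∈ walk side₁ i ⊎ (D w ⊎ w ∈ walk side₃ j) ; Xₛ = E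
      ; free₁ = proj₁ ∘ inside side₁ _ ; free₃ = proj₁ ∘ inside side₃ _
      ; freeₘ = [ proj₁ ∘ inside side₁ _ , [ M-free ∘ D⊆ , proj₁ ∘ inside side₃ _ ]′ ]′ ; freeₛ = M-free ∘ E⊆
      ; d₁₃ = cross _ _
      ; d₁ₘ = λ p → [ (λ q → apart side₁ i q p) , [ W-∉M (inside side₁ _ p) ∘ D⊆ , cross _ _ p ]′ ]′
      ; d₁ₛ = λ p → W-∉M (inside side₁ _ p) ∘ E⊆
      ; d₃ₘ = λ p → [ (λ q → cross _ _ q p) , [ W-∉M (inside side₃ _ p) ∘ D⊆ , (λ q → apart side₃ j q p) ]′ ]′
      ; d₃ₛ = λ p → W-∉M (inside side₃ _ p) ∘ E⊆
      ; dₘₛ = λ m s → [ (λ q → W-∉M (inside side₁ _ q) (E⊆ s)) , [ (λ d → dis d s) , (λ q → W-∉M (inside side₃ _ q) (E⊆ s)) ]′ ]′ m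
      ; link₁ = link side₁ _ ; link₃ = link side₃ _
      ; linkₘ = att-link inj₁ inj₂ a₁ c′ r
      ; linkₛ = l })

    kite-crossed : ∀ {i j x y x′ e} {D E : V → Set} → (∀ {w} → D w → w ∈ M) → (∀ {w} → E w → w ∈ M) →
      (∀ {w} → D w → E w → ⊥) → u₁ ~ x → Conn D x y → Att (_∈ walk side₃ j) u₃ y →
      Att (_∈ walk side₁ i) u₂ x′ → Conn E x′ e → e ~ u₄ → ⊥
    kite-crossed {i} {j} {D = D} {E} D⊆ E⊆ dis r₁ c a₃ a₂ ce re with conn-att {Z = λ w → D w ⊎ w ∈ walk side₃ j} inj₁ inj₂ c a₃
    ... | e , c′ , r = noKite (record
      { X₁ = _∈ walk side₁ (not i) ; X₃ = _∈ walk side₃ (not j)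
      ; Xₘ = λ w → D w ⊎ w ∈ walk side₃ j ; Xₛ = λ w → w ∈ walk side₁ i ⊎ E w
      ; free₁ = proj₁ ∘ inside side₁ _ ; free₃ = proj₁ ∘ inside side₃ _
      ; freeₘ = [ M-free ∘ D⊆ , proj₁ ∘ inside side₃ _ ]′ ; freeₛ = [ proj₁ ∘ inside side₁ _ , M-free ∘ E⊆ ]′
      ; d₁₃ = cross _ _
      ; d₁ₘ = λ p → [ W-∉M (inside side₁ _ p) ∘ D⊆ , cross _ _ p ]′
      ; d₁ₛ = λ p → [ (λ q → apart side₁ i q p) , W-∉M (inside side₁ _ p) ∘ E⊆ ]′
      ; d₃ₘ = λ p → [ W-∉M (inside side₃ _ p) ∘ D⊆ , (λ q → apart side₃ j q p) ]′
      ; d₃ₛ = λ p → [ (λ q → cross _ _ q p) , W-∉M (inside side₃ _ p) ∘ E⊆ ]′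
      ; dₘₛ = λ { (inj₁ d) (inj₁ q) → W-∉M (inside side₁ _ q) (D⊆ d) ; (inj₁ d) (inj₂ s) → dis d s
                ; (inj₂ q) (inj₁ q′) → cross _ _ q′ q ; (inj₂ q) (inj₂ s) → W-∉M (inside side₃ _ q) (E⊆ s) }
      ; link₁ = link side₁ _ ; link₃ = link side₃ _
      ; linkₘ = _ , e , r₁ , c′ , r
      ; linkₛ = att-link inj₁ inj₂ a₂ ce re })

    -- Order of the spokes on the ring, and moving a spoke to `u₁`

    module Moving (s : Spokes) where
      open Spokes s

      v≢ : ∀ {i j} → i ≢ j → v i ≢ v j
      v≢ ne eq = ne (apart-P (v∈P _) (subst (_∈ P _) (sym eq) (v∈P _)))

      -- Spokes 0 and 2 with `Z` join the two sides while spoke 1 with `Z′` leads from `u₂` to `u₄`,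
      -- a kite. This forces `v 1F` to lie between `v 0F` and `v 2F` on `T`.
      short-arc : ∀ {Z Z′ : V → Set} {e} → (∀ {w} → Z w → w ∈ T) → (∀ {w} → Z′ w → w ∈ T) →
        (∀ {w} → Z w → Z′ w → ⊥) → Conn Z (v 0F) (v 2F) → Conn Z′ (v 1F) e → e ~ u₄ → ⊥
      short-arc {Z} {Z′} Z⊆ Z′⊆ dis c c′ r with contact₁-att (goal 0F) | contact₃-att (goal 2F)
      ... | _ , a₁ | _ , a₃ = kite-straight {D = λ w → w ∈ P 0F ⊎ (Z w ⊎ w ∈ P 2F)} {E = λ w → w ∈ P 1F ⊎ Z′ w}
        [ P⊆M 0F , [ T⊆M ∘ Z⊆ , P⊆M 2F ]′ ]′ [ P⊆M 1F , T⊆M ∘ Z′⊆ ]′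
        (λ { (inj₁ p) (inj₁ q) → case-01 (apart-P p q)
           ; (inj₁ p) (inj₂ q) → dis (conn-head c) (subst Z′ (only 0F p (Z′⊆ q)) q)
           ; (inj₂ (inj₁ p)) (inj₁ q) → dis (subst Z (only 1F q (Z⊆ p)) p) (conn-head c′)
           ; (inj₂ (inj₁ p)) (inj₂ q) → dis p q
           ; (inj₂ (inj₂ p)) (inj₁ q) → case-21 (apart-P p q)
           ; (inj₂ (inj₂ p)) (inj₂ q) → dis (conn-last c) (subst Z′ (only 2F p (Z′⊆ q)) q) })
        a₁
        (conn-trans (conn-sym (_ , spoke 0F , inj₁)) (conn-trans (conn-mono (inj₂ ∘ inj₁) c) (_ , spoke 2F , inj₂ ∘ inj₂)))
        a₃
        (_ , _ , ~-sym (goal 1F) , conn-trans (conn-sym (_ , spoke 1F , inj₁)) (conn-mono inj₂ c′) , r)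
        where
        case-01 : _≡_ {A = Fin 3} 0F 1F → ⊥
        case-01 ()
        case-21 : _≡_ {A = Fin 3} 2F 1F → ⊥
        case-21 ()

      sp : SplitAt _~_ t₁ t₂ (v 1F) T
      sp = split-at T-chain T-unique (v∈T 1F)
      open SplitAt sp

      locate : ∀ i → i ≢ 1F → v i ∈ before ⊎ v i ∈ after
      locate i ne with ∈-++⁻ before (subst (v i ∈_) split (v∈T i))
      ... | inj₁ m = inj₁ m
      ... | inj₂ (here eq) = ⊥-elim (v≢ ne eq)
      ... | inj₂ (there m) = inj₂ m

      back-to-t₁ : Conn (_∈ (before ++ v 1F ∷ [])) (v 1F) t₁
      back-to-t₁ = conn-sym (_ , to-t , id)

      before-conn : ∀ {a} → a ∈ before → Conn (_∈ before) t₁ a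
      before-conn = prefix-within T-chain split

      after-conn : ∀ {a} → a ∈ after → Conn (_∈ after) a t₂
      after-conn = suffix-within from-t

      -- Hides the direction of `T`: `A` is the part beyond `v 1F` on the side of `v 0F`, and `B`
      -- the part on the side of `v 2F`.
      record Between : Set₁ where
        field
          A B : V → Set
          A⊆T : ∀ {w} → A w → w ∈ T
          B⊆T : ∀ {w} → B w → w ∈ T
          A∌v₁ : ¬ A (v 1F)
          A∩B : ∀ {w} → A w → B w → ⊥
          v₀∈A : A (v 0F)
          v₂∈B : B (v 2F)
          leave₀ : ∃[ e ] (Conn A (v 0F) e × e ~ u₄)
          leave₁ : ∃[ e ] (Conn (λ w → A w ⊎ w ≡ v 1F) (v 1F) e × e ~ u₄)
          arc : Conn (λ w → B w ⊎ w ≡ v 1F) (v 1F) (v 2F)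

      last-v₁ : ∀ {w} → w ∈ (before ++ v 1F ∷ []) → w ∈ before ⊎ w ≡ v 1F
      last-v₁ m with ∈-++⁻ before m
      ... | inj₁ p = inj₁ p
      ... | inj₂ (here eq) = inj₂ eq

      first-v₁ : ∀ {w} → w ∈ (v 1F ∷ after) → w ∈ after ⊎ w ≡ v 1F
      first-v₁ (here eq) = inj₂ eq
      first-v₁ (there m) = inj₁ m

      sides : (v 0F ∈ before × v 2F ∈ after) ⊎ (v 0F ∈ after × v 2F ∈ before)
      sides with locate 0F (λ ()) | locate 2F (λ ())
      ... | inj₁ p | inj₂ q = inj₁ (p , q)
      ... | inj₂ p | inj₁ q = inj₂ (p , q)
      ... | inj₁ p | inj₁ q = ⊥-elim (short-arc before⊆ (subst (_ ∈_) (sym split) ∘ ∈-++⁺ʳ before)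
              (λ { b (here refl) → t∉before b ; b (there a) → separated b a })
              (conn-trans (conn-sym (before-conn p)) (before-conn q)) (_ , from-t , id) t₂~u₄)
      ... | inj₂ p | inj₂ q = ⊥-elim (short-arc after⊆ ([ before⊆ , (λ { refl → v∈T 1F }) ]′ ∘ last-v₁)
              (λ a → [ (λ b → separated b a) , (λ { refl → t∉after a }) ]′ ∘ last-v₁)
              (conn-trans (after-conn p) (conn-sym (after-conn q))) back-to-t₁ t₁~u₄)

      between : Between
      between with sides
      ... | inj₁ (p , q) = record
        { A = _∈ before ; B = _∈ after ; A⊆T = before⊆ ; B⊆T = after⊆ ; A∌v₁ = t∉before ; A∩B = separated
        ; v₀∈A = p ; v₂∈B = q
        ; leave₀ = _ , conn-sym (before-conn p) , t₁~u₄
        ; leave₁ = _ , conn-mono last-v₁ back-to-t₁ , t₁~u₄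
        ; arc = conn-mono first-v₁ (chain-to from-t (there q)) }
      ... | inj₂ (p , q) = record
        { A = _∈ after ; B = _∈ before ; A⊆T = after⊆ ; B⊆T = before⊆ ; A∌v₁ = t∉after ; A∩B = λ a b → separated b a
        ; v₀∈A = p ; v₂∈B = q
        ; leave₀ = _ , after-conn p , t₂~u₄
        ; leave₁ = _ , conn-mono first-v₁ (_ , from-t , id) , t₂~u₄
        ; arc = conn-mono last-v₁ (conn-sym (chain-from to-t (∈-++⁺ˡ q))) }

      Φ : V → Set
      Φ w = w ∈ T ⊎ ∃[ i ] w ∈ P i

      Φ? : Decidable Φ
      Φ? w = (w ∈? T) ⊎-dec Fₚ.any? (λ i → w ∈? P i)

      replace : ∀ {y m ys} → Chain _~_ y m ys → y ∈ T → (∀ {w} → w ∈ ys → w ∈ M) →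
        (∀ {w} → w ∈ ys → w ∈ T → w ≡ y) → (∀ i {w} → w ∈ ys → w ∈ P (suc i) → ⊥) → u₁ ~ m →
        Σ Spokes λ s′ → (u₁ ~ Spokes.x s′ 0F) × Spokes.x s′ 2F ≡ x 2F
      replace {y} {m} {ys} c y∈ ⊆M on off r = record
        { P = P′ ; v = v′ ; x = x′
        ; spoke = λ { 0F → c ; (suc i) → spoke (suc i) }
        ; v∈T = λ { 0F → y∈ ; (suc i) → v∈T (suc i) }
        ; P⊆M = λ { 0F → ⊆M ; (suc i) → P⊆M (suc i) }
        ; only = λ { 0F → on ; (suc i) → only (suc i) }
        ; apart-P = λ {i} {j} → dis i j
        ; goal = λ { 0F → inj₁ r ; 1F → goal 1F ; 2F → goal 2F } } , r , refl
        where
        P′ : Fin 3 → List V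
        P′ 0F = ys
        P′ (suc i) = P (suc i)
        v′ x′ : Fin 3 → V
        v′ 0F = y
        v′ (suc i) = v (suc i)
        x′ 0F = m
        x′ (suc i) = x (suc i)
        dis : ∀ i j {w} → w ∈ P′ i → w ∈ P′ j → i ≡ j
        dis 0F 0F _ _ = refl
        dis 0F (suc j) p q = ⊥-elim (off j p q)
        dis (suc i) 0F p q = ⊥-elim (off i q p)
        dis (suc i) (suc j) p q = apart-P p q

      -- A walk in `M` from a neighbour of `u₁` is stopped where it first meets the ring or a spoke:
      -- spokes 1 and 2 give kites, spoke 0 and the ring a new spoke. The last equation ensures that
      -- the mirrored move does not undo this one.
      move : Σ Spokes λ s′ → (u₁ ~ Spokes.x s′ 0F) × Spokes.x s′ 2F ≡ x 2F
      move with goal 0F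
      ... | inj₁ r = s , r , refl
      ... | inj₂ (i , c , c∈ , rc) with touch₁
      ...   | m , m∈ , rm with M-conn m∈ (T⊆M (v∈T 0F))
      ...     | xs , ch , inM with first-hit Φ? ch (inj₁ (v∈T 0F))
      ...       | y , ys , ch′ , φ , sub , off = go φ
        where
        open Between between
        ys⊆M : ∀ {w} → w ∈ ys → w ∈ M
        ys⊆M = inM ∘ sub
        ends : ∀ {w} → w ∈ ys → Φ w → w ≡ y
        ends w∈ f = [ id , (λ (¬f , _) → ⊥-elim (¬f f)) ]′ (off w∈)
        go : Φ y → _
        go _ with y ∈? P 1F
        -- The path from `u₁` goes on over spoke 1, `B` and spoke 2 to `u₃`. Spoke 1 no longer
        -- serves `u₂`, which reaches `u₄` along walk `i` of the first side, spoke 0 and `A`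
        -- instead.
        ... | yes y₁ with leave₀ | contact₃-att (goal 2F)
        ...   | e , ce , re | _ , a₃ = ⊥-elim (kite-crossed
                {D = λ w → w ∈ ys ⊎ (w ∈ P 1F ⊎ (B w ⊎ w ∈ P 2F))} {E = λ w → w ∈ P 0F ⊎ A w}
                [ ys⊆M , [ P⊆M 1F , [ T⊆M ∘ B⊆T , P⊆M 2F ]′ ]′ ]′ [ P⊆M 0F , T⊆M ∘ A⊆T ]′ dis
                (~-sym rm)
                (conn-trans (_ , ch′ , inj₁) (conn-trans (conn-sym (conn-mono (inj₂ ∘ inj₁) (chain-to (spoke 1F) y₁)))
                  (conn-trans (conn-mono [ inj₂ ∘ inj₂ ∘ inj₁ , (λ { refl → inj₂ (inj₁ (v∈P 1F)) }) ]′ arc)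
                              (_ , spoke 2F , inj₂ ∘ inj₂ ∘ inj₂))))
                a₃ (att-u side₁ i c∈ rc)
                (conn-trans (conn-sym (_ , spoke 0F , inj₁)) (conn-mono inj₂ ce)) re)
          where
          dis : ∀ {w} → w ∈ ys ⊎ (w ∈ P 1F ⊎ (B w ⊎ w ∈ P 2F)) → w ∈ P 0F ⊎ A w → ⊥
          dis (inj₁ p) (inj₁ q) with ends p (inj₂ (_ , q))
          ... | refl with apart-P y₁ q
          ...   | ()
          dis (inj₁ p) (inj₂ q) with ends p (inj₁ (A⊆T q))
          ... | refl = A∌v₁ (subst A (only 1F y₁ (A⊆T q)) q)
          dis (inj₂ (inj₁ p)) (inj₁ q) with apart-P p q
          ... | ()
          dis (inj₂ (inj₁ p)) (inj₂ q) = A∌v₁ (subst A (only 1F p (A⊆T q)) q)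
          dis (inj₂ (inj₂ (inj₁ p))) (inj₁ q) = A∩B v₀∈A (subst B (only 0F q (B⊆T p)) p)
          dis (inj₂ (inj₂ (inj₁ p))) (inj₂ q) = A∩B q p
          dis (inj₂ (inj₂ (inj₂ p))) (inj₁ q) with apart-P p q
          ... | ()
          dis (inj₂ (inj₂ (inj₂ p))) (inj₂ q) = A∩B (subst A (only 2F p (A⊆T q)) q) v₂∈B
        go _ | no ¬y₁ with y ∈? P 2F
        -- The path from `u₁` goes straight on along spoke 2 to `u₃`. Spoke 0 is idle, so `u₂`
        -- reaches `u₄` over spoke 1 and through `A`.
        ... | yes y₂ with leave₁ | contact₃-att (goal 2F)
        ...   | e , ce , re | _ , a₃ = ⊥-elim (kite-straight {i = true}
                {D = λ w → w ∈ ys ⊎ w ∈ P 2F} {E = λ w → w ∈ P 1F ⊎ A w}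
                [ ys⊆M , P⊆M 2F ]′ [ P⊆M 1F , T⊆M ∘ A⊆T ]′ dis
                (inj₁ (~-sym rm))
                (conn-trans (_ , ch′ , inj₁) (conn-mono inj₂ (chain-from (spoke 2F) y₂)))
                a₃
                (_ , e , ~-sym (goal 1F) , conn-trans (conn-sym (_ , spoke 1F , inj₁))
                   (conn-mono [ inj₂ , (λ { refl → inj₁ (v∈P 1F) }) ]′ ce) , re))
          where
          dis : ∀ {w} → w ∈ ys ⊎ w ∈ P 2F → w ∈ P 1F ⊎ A w → ⊥
          dis (inj₁ p) (inj₁ q) with ends p (inj₂ (_ , q))
          ... | refl = ¬y₁ q
          dis (inj₁ p) (inj₂ q) with ends p (inj₁ (A⊆T q))
          ... | refl = A∩B (subst A (only 2F y₂ (A⊆T q)) q) v₂∈B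
          dis (inj₂ p) (inj₁ q) with apart-P p q
          ... | ()
          dis (inj₂ p) (inj₂ q) = A∩B (subst A (only 2F p (A⊆T q)) q) v₂∈B
        go φ | no ¬y₁ | no ¬y₂ with y ∈? P 0F
        ... | yes y₀ with prefix (spoke 0F) y₀
        ...   | zs , cz , zsub with join cz (reverse-chain ~-sym ch′)
        ...     | ws , cw , wsub = replace cw (v∈T 0F)
                    (λ w∈ → [ P⊆M 0F ∘ zsub , ys⊆M ∘ ∈-reverse⁻ ]′ (wsub w∈))
                    (λ w∈ t → [ (λ p → only 0F (zsub p) t) , (λ p → on-ys (∈-reverse⁻ p) t) ]′ (wsub w∈))
                    (λ j w∈ q → [ (λ p → 0≢suc (apart-P (zsub p) q)) , (λ p → off-ys j (∈-reverse⁻ p) q) ]′ (wsub w∈))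
                    (~-sym rm)
          where
          0≢suc : ∀ {j : Fin 2} → _≡_ {A = Fin 3} 0F (suc j) → ⊥
          0≢suc ()
          on-ys : ∀ {w} → w ∈ ys → w ∈ T → w ≡ v 0F
          on-ys p t with ends p (inj₁ t)
          ... | refl = only 0F y₀ t
          off-ys : ∀ j {w} → w ∈ ys → w ∈ P (suc j) → ⊥
          off-ys j p q with ends p (inj₂ (_ , q))
          ... | refl = 0≢suc (apart-P y₀ q)
        go (inj₂ (0F , q)) | no _ | no _ | no ¬y₀ = ⊥-elim (¬y₀ q)
        go (inj₂ (1F , q)) | no ¬y₁ | no _ | no _ = ⊥-elim (¬y₁ q)
        go (inj₂ (2F , q)) | no _ | no ¬y₂ | no _ = ⊥-elim (¬y₂ q)
        go (inj₁ y∈T) | no ¬y₁ | no ¬y₂ | no _ = replace (reverse-chain ~-sym ch′) y∈T (ys⊆M ∘ ∈-reverse⁻)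
          (λ p t → ends (∈-reverse⁻ p) (inj₁ t)) off-ys (~-sym rm)
          where
          off-ys : ∀ j {w} → w ∈ reverse ys → w ∈ P (suc j) → ⊥
          off-ys j p q with ends (∈-reverse⁻ p) (inj₂ (_ , q))
          off-ys 0F p q | refl = ¬y₁ q
          off-ys 1F p q | refl = ¬y₂ q

  module Spoking (σ : Setting) (ring : Ring (Setting.M σ) (Setting.u₄ σ)) where
    private
      module L = Linking σ ring
      module L′ = Linking (swap-setting σ) ring

    turn : Fin 3 → Fin 3
    turn 0F = 2F
    turn 1F = 1F
    turn 2F = 0F

    turn-inj : ∀ i j → turn i ≡ turn j → i ≡ j
    turn-inj 0F 0F _ = refl
    turn-inj 1F 1F _ = refl
    turn-inj 2F 2F _ = refl
    turn-inj 0F 1F ()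
    turn-inj 0F 2F ()
    turn-inj 1F 0F ()
    turn-inj 1F 2F ()
    turn-inj 2F 0F ()
    turn-inj 2F 1F ()

    swap-spokes : L.Spokes → L′.Spokes
    swap-spokes s = record
      { P = P ∘ turn ; v = v ∘ turn ; x = x ∘ turn ; spoke = λ i → spoke (turn i) ; v∈T = λ i → v∈T (turn i)
      ; P⊆M = λ i → P⊆M (turn i) ; only = λ i → only (turn i)
      ; apart-P = λ {i} {j} p q → turn-inj i j (apart-P p q)
      ; goal = λ { 0F → goal 2F ; 1F → goal 1F ; 2F → goal 0F } }
      where open L.Spokes s

    swap-spokes′ : L′.Spokes → L.Spokes
    swap-spokes′ s = record
      { P = P ∘ turn ; v = v ∘ turn ; x = x ∘ turn ; spoke = λ i → spoke (turn i) ; v∈T = λ i → v∈T (turn i)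
      ; P⊆M = λ i → P⊆M (turn i) ; only = λ i → only (turn i)
      ; apart-P = λ {i} {j} p q → turn-inj i j (apart-P p q)
      ; goal = λ { 0F → goal 2F ; 1F → goal 1F ; 2F → goal 0F } }
      where open L′.Spokes s

    anchored : Σ L.Spokes λ s → (L.u₁ ~ L.Spokes.x s 0F) × (L.u₃ ~ L.Spokes.x s 2F)
    anchored with L.Moving.move L.spokes
    ... | s , r₁ , _ with L′.Moving.move (swap-spokes s)
    ...   | s′ , r₃ , eq = swap-spokes′ s′ , subst (L.u₁ ~_) (sym eq) r₁ , r₃

  -- Existence of the ring

  module Closing (σ : Setting) where
    open Neighbours σ

    ring-or-edge : ∀ {a b} → a ∈ M → b ∈ M → a ≢ b → u₄ ~ a → u₄ ~ b → Ring M u₄ ⊎ a ~ b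
    ring-or-edge a∈ b∈ ne ra rb with M-conn a∈ b∈
    ... | xs , c , inM with shorten Fₚ._≟_ c
    ...   | _ , stop _ , _ , _ = ⊥-elim (ne refl)
    ...   | _ , r ∷ stop _ , _ , _ = inj₂ r
    ...   | _ , d@(r ∷ (r′ ∷ d′)) , u , sub = inj₁ (record
              { T = _ ; t₁ = _ ; t₂ = _ ; T-chain = d ; T-unique = u ; T⊆M = inM ∘ sub
              ; t₁~u₄ = ~-sym ra ; t₂~u₄ = ~-sym rb ; 3≤T = s≤s (s≤s (nonempty d′)) })

    -- Three neighbours of `u₄` in `M` suffice: if neither consecutive pair is joined by a longer
    -- path, their two edges form a path on three vertices.
    ring : Ring M u₄
    ring with u₄-neighbour [] (s≤s z≤n) (λ ())
    ... | a , a∈ , ra , _ with u₄-neighbour (a ∷ []) (s≤s (s≤s z≤n)) (λ { (here refl) → ~-irrefl ra })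
    ...   | b , b∈ , rb , b∉ with u₄-neighbour (b ∷ a ∷ []) (s≤s (s≤s (s≤s z≤n))) (λ { (here refl) → ~-irrefl rb ; (there (here refl)) → ~-irrefl ra })
    ...     | c , c∈ , rc , c∉ with ring-or-edge a∈ b∈ (λ { refl → b∉ (here refl) }) ra rb | ring-or-edge b∈ c∈ (λ { refl → c∉ (here refl) }) rb rc
    ...       | inj₁ R | _ = R
    ...       | inj₂ _ | inj₁ R = R
    ...       | inj₂ ab | inj₂ bc = record
                { T = a ∷ b ∷ c ∷ [] ; t₁ = a ; t₂ = c ; T-chain = ab ∷ (bc ∷ stop c)
                ; T-unique = ((λ { refl → b∉ (here refl) }) ∷ (λ { refl → c∉ (there (here refl)) }) ∷ []) ∷ ((λ { refl → c∉ (here refl) }) ∷ []) ∷ [] ∷ []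
                ; T⊆M = λ { (here refl) → a∈ ; (there (here refl)) → b∈ ; (there (there (here refl))) → c∈ }
                ; t₁~u₄ = ~-sym ra ; t₂~u₄ = ~-sym rc ; 3≤T = s≤s (s≤s (s≤s z≤n)) }

  -- Existence of the extremal configuration

  module Fans (u₁ u₂ u₃ : V) where

    Src Snk : Fin 4 → V → Set
    Src _ v = u₂ ~ v
    Snk j v = v ~ tip u₁ u₃ j

    fan : ∀ {X} → Decidable X → Routing X Src Snk ⊎ Cut X Src Snk
    fan X? = route _ Src Snk X? (λ _ v → u₂ ~? v) (λ j v → v ~? tip u₁ u₃ j)

    routing-arms : ∀ {X} → Routing X Src Snk → Arms u₁ u₂ u₃ X
    routing-arms r =
      routing-pair r (λ { false → 0F ; true → 1F }) (λ { false () ; true () }) (λ i → R.from-src _) (λ { false → R.to-snk 0F ; true → R.to-snk 1F }) ,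
      routing-pair r (λ { false → 2F ; true → 3F }) (λ { false () ; true () }) (λ i → R.from-src _) (λ { false → R.to-snk 2F ; true → R.to-snk 3F }) ,
      λ { false false m m′ → 0≢2 (R.disjoint m m′) ; false true m m′ → 0≢3 (R.disjoint m m′)
        ; true false m m′ → 1≢2 (R.disjoint m m′) ; true true m m′ → 1≢3 (R.disjoint m m′) }
      where
      module R = Routing r
      0≢2 : _≢_ {A = Fin 4} 0F 2F
      0≢2 ()
      0≢3 : _≢_ {A = Fin 4} 0F 3F
      0≢3 ()
      1≢2 : _≢_ {A = Fin 4} 1F 2F
      1≢2 ()
      1≢3 : _≢_ {A = Fin 4} 1F 3F
      1≢3 ()

    cut-no-arms : ∀ {X} → Cut X Src Snk → ¬ Arms u₁ u₂ u₃ X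
    cut-no-arms c a = ℕₚ.<-irrefl refl (ℕₚ.≤-trans small
      (Crossing.bound id id arm id id (arm-disjoint _ _) arm-chain arm-inside))
      where
      open Cut c
      open ArmIndex a

    -- Menger's theorem decides this, since a cut with fewer than four elements excludes four
    -- disjoint walks. The decision is what makes the greedy growth of `M` effective.
    arms? : ∀ {X} → Decidable X → Dec (Arms u₁ u₂ u₃ X)
    arms? X? with fan X?
    ... | inj₁ r = yes (routing-arms r)
    ... | inj₂ c = no (cut-no-arms c)

  module Maximal (u₁ u₂ u₃ u₄ : V) (1≢2 : u₁ ≢ u₂) (1≢3 : u₁ ≢ u₃) (1≢4 : u₁ ≢ u₄)
    (2≢3 : u₂ ≢ u₃) (2≢4 : u₂ ≢ u₄) (3≢4 : u₃ ≢ u₄)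
    (noKite : Kite (Apart u₁ u₂ u₃ u₄) u₁ u₂ u₃ u₄ → ⊥) where

    open Fans u₁ u₂ u₃

    Free : V → Set
    Free = Apart u₁ u₂ u₃ u₄

    Outer : List V → V → Set
    Outer M v = Free v × v ∉ M

    Outer? : ∀ M → Decidable (Outer M)
    Outer? M v = Apart? u₁ u₂ u₃ u₄ v ×-dec ¬? (v ∈? M)

    record Good (M : List V) : Set where
      field
        unique : Unique M
        free   : ∀ {v} → v ∈ M → Free v
        conn   : ∀ {a b} → a ∈ M → b ∈ M → Conn (_∈ M) a b
        touch  : ∃[ m ] (m ∈ M × m ~ u₄)
        arms   : Arms u₁ u₂ u₃ (Outer M)

    Extends : List V → V → Set
    Extends M w = Outer M w × (∃[ m ] (m ∈ M × m ~ w)) × Arms u₁ u₂ u₃ (λ v → Outer M v × v ≢ w)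

    extend : ∀ {M w} → Good M → Extends M w → Good (w ∷ M)
    extend {M} {w} g ((f , w∉) , (m , m∈ , r) , p , q , cr) = record
      { unique = All.tabulate (λ { m refl → w∉ m }) ∷ unique
      ; free = λ { (here refl) → f ; (there m) → free m }
      ; conn = λ { (here refl) (here refl) → conn-refl (here refl)
                 ; (here refl) (there b) → conn-sym (to-w b)
                 ; (there a) (here refl) → to-w a
                 ; (there a) (there b) → conn-mono there (conn a b) }
      ; touch = let m , m∈ , r = touch in m , there m∈ , r
      ; arms = pair-mono p (λ i k → out (inside p i k)) , pair-mono q (λ i k → out (inside q i k)) , cr }
      where
      open Good g
      to-w : ∀ {a} → a ∈ M → Conn (_∈ (w ∷ M)) a w
      to-w a = conn-snoc (conn-mono there (conn a m∈)) r (here refl)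
      out : ∀ {v} → Outer M v × v ≢ w → Outer (w ∷ M) v
      out ((f , v∉) , ne) = f , λ { (here e) → ne e ; (there k) → v∉ k }

    unique-length : ∀ {M} → Unique M → length M ≤ n
    unique-length {M} u = ℕₚ.≤-trans (injection-length (lookup M) (allFin n) (Unique-lookup u) (λ i → ∈-allFin _))
      (ℕₚ.≤-reflexive (Lₚ.length-tabulate id))

    -- `k` bounds the additions still possible, because `M` has no repetitions and so at most `n`
    -- entries. The equation on `roots` is needed because a `Setting` carries its roots as fields.
    maximize : ∀ k M → n ≤ k + length M → Good M →
      Σ Setting λ σ → Setting.roots σ ≡ (u₁ , u₂ , u₃ , u₄)
    maximize k M le g with Fₚ.any? (λ w → Outer? M w ×-dec (Fₚ.any? (λ m → (m ∈? M) ×-dec (m ~? w))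
                               ×-dec arms? (λ v → Outer? M v ×-dec ¬? (v Fₚ.≟ w))))
    ... | no none = record
          { u₁ = u₁ ; u₂ = u₂ ; u₃ = u₃ ; u₄ = u₄
          ; 1≢2 = 1≢2 ; 1≢3 = 1≢3 ; 1≢4 = 1≢4 ; 2≢3 = 2≢3 ; 2≢4 = 2≢4 ; 3≢4 = 3≢4
          ; noKite = noKite ; M = M ; M-free = free ; M-conn = conn ; touch₄ = touch ; arms = arms
          ; maximal = λ w t a → none (_ , w , t , a) } , refl
      where open Good g
    maximize zero M le g | yes (w , ext) = ⊥-elim (ℕₚ.<-irrefl refl
      (ℕₚ.≤-trans (unique-length (Good.unique (extend g ext))) le))
    maximize (suc k) M le g | yes (w , ext) =
      maximize k (w ∷ M) (ℕₚ.≤-trans le (ℕₚ.≤-reflexive (sym (ℕₚ.+-suc k (length M))))) (extend g ext)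

    module _ {m₀ : V} (f₀ : Free m₀) where

      module _ (c : Cut (Outer (m₀ ∷ [])) Src Snk) where
        open Cut c

        -- An open gate at `w` contradicts the cut: `w` has a neighbour `b` outside it, and `u₂`
        -- reaches `b` around it, with at most seven vertices avoided both times. `w` and `w′` stand
        -- for `u₁` and `u₃` in either order.
        blocked : ∀ {j w w′} → snk j ∉ S → (∀ {b} → b ~ w → Snk j b) → w ∉ (m₀ ∷ u₂ ∷ w′ ∷ u₄ ∷ verts S) →
          (∀ {b} → b ≢ w → b ≢ w′ → b ≢ u₁ × b ≢ u₃) → ⊥
        blocked {j} {w} {w′} j∉ gate w∉ off with neighbour w (m₀ ∷ u₂ ∷ w′ ∷ u₄ ∷ verts S)
               (ℕₚ.+-monoʳ-≤ 5 (ℕₚ.≤-trans (verts-length S) (ℕₚ.≤-pred small))) w∉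
        ... | b , rb , b∉ with off {b} (λ { refl → ~-irrefl rb }) (b∉ ∘ there ∘ there ∘ here)
        ...   | b≢u₁ , b≢u₃ with connected (m₀ ∷ u₁ ∷ u₃ ∷ u₄ ∷ verts S)
               (ℕₚ.+-monoʳ-≤ 5 (ℕₚ.≤-trans (verts-length S) (ℕₚ.≤-pred small))) {u₂} {b}
               (λ { (here e) → proj₁ (proj₂ f₀) (sym e) ; (there (here e)) → 1≢2 (sym e) ; (there (there (here e))) → 2≢3 e
                  ; (there (there (there (here e)))) → 2≢4 e
                  ; (there (there (there (there m)))) → proj₁ (proj₂ (proj₁ (within m))) refl })
               (λ { (here e) → b∉ (here e) ; (there (here e)) → b≢u₁ e ; (there (there (here e))) → b≢u₃ e
                  ; (there (there (there m))) → b∉ (there (there (there m))) })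
        ...     | _ , stop _ , _ = b∉ (there (here refl))
        ...     | _ , r ∷ ch , px ∷ _ , av = blocks (proj₂ free-source) j∉ r (gate (~-sym rb))
                  (_ , ch , λ m → let v∉ = av (there m) in
                    ((v∉ ∘ there ∘ here , All.lookup px m ∘ sym , v∉ ∘ there ∘ there ∘ here , v∉ ∘ there ∘ there ∘ there ∘ here) ,
                     λ { (here e) → v∉ (here e) }) , v∉ ∘ there ∘ there ∘ there ∘ there)

        blocked₁ : ∀ {j} → snk j ∉ S → (∀ {b} → b ~ u₁ → Snk j b) → ⊥
        blocked₁ {j} j∉ gate = blocked {j} {u₁} {u₃} j∉ gate
          (λ { (here e) → proj₁ f₀ (sym e) ; (there (here e)) → 1≢2 e
             ; (there (there (here e))) → 1≢3 e ; (there (there (there (here e)))) → 1≢4 e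
             ; (there (there (there (there m)))) → proj₁ (proj₁ (within m)) refl }) _,_

        blocked₃ : ∀ {j} → snk j ∉ S → (∀ {b} → b ~ u₃ → Snk j b) → ⊥
        blocked₃ {j} j∉ gate = blocked {j} {u₃} {u₁} j∉ gate
          (λ { (here e) → proj₁ (proj₂ (proj₂ f₀)) (sym e) ; (there (here e)) → 2≢3 (sym e)
             ; (there (there (here e))) → 1≢3 (sym e) ; (there (there (there (here e)))) → 3≢4 e
             ; (there (there (there (there m)))) → proj₁ (proj₂ (proj₂ (proj₁ (within m)))) refl }) (λ p q → q , p)

        no-cut : ⊥
        no-cut with free-sink
        ... | 0F , j∉ = blocked₁ j∉ id
        ... | 1F , j∉ = blocked₁ j∉ id
        ... | 2F , j∉ = blocked₃ j∉ id
        ... | 3F , j∉ = blocked₃ j∉ id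

      first-arms : Arms u₁ u₂ u₃ (Outer (m₀ ∷ []))
      first-arms with fan (Outer? (m₀ ∷ []))
      ... | inj₁ r = routing-arms r
      ... | inj₂ c = ⊥-elim (no-cut c)

    setting : Σ Setting λ σ → Setting.roots σ ≡ (u₁ , u₂ , u₃ , u₄)
    setting with neighbour u₄ (u₁ ∷ u₂ ∷ u₃ ∷ []) (ℕₚ.m≤n+m 4 4)
        (λ { (here e) → 1≢4 (sym e) ; (there (here e)) → 2≢4 (sym e) ; (there (there (here e))) → 3≢4 (sym e) })
    ... | m₀ , r , m₀∉ = maximize n (m₀ ∷ []) (ℕₚ.m≤m+n n 1) (record
        { unique = [] ∷ [] ; free = λ { (here refl) → f₀ }
        ; conn = λ { (here refl) (here refl) → conn-refl (here refl) }
        ; touch = m₀ , here refl , ~-sym r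
        ; arms = first-arms f₀ })
      where
      f₀ : Free m₀
      f₀ = m₀∉ ∘ here , m₀∉ ∘ there ∘ here , m₀∉ ∘ there ∘ there ∘ here , λ { refl → ~-irrefl r }

-- A finite subgraph with decidable adjacency

-- The paths provided by connectivity use finitely many edges, and these already form an
-- 8-connected subgraph; membership in it is decidable although Adj need not be.
module Extraction {n : ℕ} (G : SimpleGraph n) (kc : KConnected G 8) where

  private
    V = Fin n
    _∈?_ = Menger._∈?_ (Fₚ._≟_ {n})

  AdjPair : Set
  AdjPair = Σ (V × V) λ e → Adj G (proj₁ e) (proj₂ e)

  steps : ∀ {a b xs} → Walk G a b xs → List AdjPair
  steps (single _) = []
  steps (step r w) = (_ , r) ∷ steps w

  -- The conditions are premises, so that `entry` is total and can be tabulated over all `S`, `a`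
  -- and `b`.
  Wanted : List V → V → V → List AdjPair → Set
  Wanted S a b es = length S < 8 → a ∉ S → b ∉ S →
    ∃[ xs ] Σ (Walk G a b xs) λ w → Unique xs × (∀ {v} → v ∈ xs → v ∉ S) × (∀ {e} → e ∈ steps w → e ∈ es)

  entry : ∀ S a b → Σ (List AdjPair) (Wanted S a b)
  entry S a b with length S ℕₚ.<? 8 | a ∈? S | b ∈? S
  ... | yes lt | no a∉ | no b∉ = let xs , (w , u) , d = proj₂ kc S lt a b a∉ b∉ in
        steps w , λ _ _ _ → xs , w , u , d , id
  ... | no nlt | _ | _ = [] , λ lt → ⊥-elim (nlt lt)
  ... | yes _ | yes a∈ | _ = [] , λ _ a∉ → ⊥-elim (a∉ a∈)
  ... | yes _ | no _ | yes b∈ = [] , λ _ _ b∉ → ⊥-elim (b∉ b∈)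

  lists : ℕ → List (List V)
  lists zero    = [] ∷ []
  lists (suc k) = [] ∷ concatMap (λ v → map (v ∷_) (lists k)) (allFin n)

  ∈-lists : ∀ k S → length S ≤ k → S ∈ lists k
  ∈-lists zero [] _ = here refl
  ∈-lists (suc k) [] _ = here refl
  ∈-lists (suc k) (v ∷ S) (s≤s le) =
    there (∈-concatMap⁺ _ (Any.map (λ { refl → ∈-map⁺ (v ∷_) (∈-lists k S le) }) (∈-allFin v)))

  edges : List AdjPair
  -- Deletion sets in 8-connectivity have at most 7 entries.
  edges = concatMap (λ S → concatMap (λ a → concatMap (λ b → proj₁ (entry S a b)) (allFin n)) (allFin n)) (lists 7)

  entry⊆edges : ∀ {S a b e} → length S < 8 → e ∈ proj₁ (entry S a b) → e ∈ edges
  entry⊆edges {S} {a} {b} (s≤s le) m =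
    ∈-concatMap⁺ _ (Any.map (λ { refl → ∈-concatMap⁺ _ (Any.map (λ { refl →
      ∈-concatMap⁺ _ (Any.map (λ { refl → m }) (∈-allFin b)) }) (∈-allFin a)) }) (∈-lists 7 S le))

  pairs : List (V × V)
  pairs = map proj₁ edges

  _~_ : V → V → Set
  x ~ y = (x , y) ∈ pairs ⊎ (y , x) ∈ pairs

  _~?_ : ∀ x y → Dec (x ~ y)
  x ~? y = ((x , y) ∈ₚ? pairs) ⊎-dec ((y , x) ∈ₚ? pairs)
    where _∈ₚ?_ = Menger._∈?_ (×-≡-dec (Fₚ._≟_ {n}) Fₚ._≟_)

  ~-sym : ∀ {x y} → x ~ y → y ~ x
  ~-sym = swap

  ~⇒Adj : ∀ {x y} → x ~ y → Adj G x y
  ~⇒Adj (inj₁ m) with ∈-map⁻ proj₁ m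
  ... | (_ , r) , _ , refl = r
  ~⇒Adj (inj₂ m) with ∈-map⁻ proj₁ m
  ... | (_ , r) , _ , refl = Adj-sym G r

  ~-irrefl : ∀ {x} → ¬ (x ~ x)
  ~-irrefl r = irrefl G (~⇒Adj r)

  connected : ∀ S → length S < 8 → ∀ {a b} → a ∉ S → b ∉ S →
     ∃[ xs ] (Chain _~_ a b xs × Unique xs × ∀ {v} → v ∈ xs → v ∉ S)
  connected S lt {a} {b} a∉ b∉ with proj₂ (entry S a b) lt a∉ b∉
  ... | xs , w , u , d , sub = xs , chain-of w (entry⊆edges {S} {a} {b} lt ∘ sub) , u , d
    where
    chain-of : ∀ {a b xs} (w : Walk G a b xs) → (∀ {e} → e ∈ steps w → e ∈ edges) → Chain _~_ a b xs
    chain-of (single a) _ = stop a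
    chain-of (step r w) s = inj₁ (∈-map⁺ proj₁ (s (here refl))) ∷ chain-of w (s ∘ there)

-- From regions to kite-linkages and flowers

module Assembly {n : ℕ} (G : SimpleGraph n) (_~_ : Fin n → Fin n → Set) (_~?_ : ∀ x y → Dec (x ~ y))
  (~-sym : ∀ {x y} → x ~ y → y ~ x) (~-irrefl : ∀ {x} → ¬ (x ~ x)) (8<n : 8 < n)
  (connected : ∀ S → length S < 8 → ∀ {a b} → a ∉ S → b ∉ S →
     ∃[ xs ] (Chain _~_ a b xs × Unique xs × ∀ {v} → v ∈ xs → v ∉ S))
  (~⇒Adj : ∀ {x y} → x ~ y → Adj G x y) where

  open Graph _~_ _~?_ ~-sym ~-irrefl 8<n connected

  walk-of : ∀ {a b xs} → Chain _~_ a b xs → Walk G a b xs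
  walk-of (stop a) = single a
  walk-of (r ∷ c)  = step (~⇒Adj r) (walk-of c)

  record Trail (s t : V) (X : V → Set) : Set where
    field
      P      : List V
      isPath : IsPath G s t P
      on     : ∀ {v} → v ∈ P → v ≡ s ⊎ v ≡ t ⊎ X v
      within : ∀ {v} → v ∈ inner P → X v

  trail : ∀ {s t X} → Link X s t → Trail s t X
  trail {s} {t} {X} (a , b , r , (xs , c , inX) , r′) with shorten Fₚ._≟_ (r ∷ append c r′ (stop t))
  ... | ys , d , u , sub = record
    { P = ys ; isPath = walk-of d , u ; on = on
    ; within = λ m → let p , ne , ne′ = inner-ends d u m in
        [ ⊥-elim ∘ ne , [ ⊥-elim ∘ ne′ , id ]′ ]′ (on p) }
    where
    on : ∀ {v} → v ∈ ys → v ≡ s ⊎ v ≡ t ⊎ X v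
    on m with sub m
    ... | here e = inj₁ e
    ... | there m′ with ∈-++⁻ xs m′
    ...   | inj₁ p = inj₂ (inj₂ (inX p))
    ...   | inj₂ (here e) = inj₂ (inj₁ e)

  internally-disjoint : ∀ {s t s′ t′ X X′} (p : Trail s t X) (q : Trail s′ t′ X′) → (∀ {v} → X v → X′ v → ⊥) →
    (∀ {v} → X v → v ≢ s′ × v ≢ t′) → (∀ {v} → X′ v → v ≢ s × v ≢ t) → InternallyDisjoint (Trail.P p) (Trail.P q)
  internally-disjoint p q dis f g =
    (λ m m′ → let x = Trail.within q m′ in
       [ proj₁ (g x) , [ proj₂ (g x) , (λ y → dis y x) ]′ ]′ (Trail.on p m)) ,
    (λ m m′ → let x = Trail.within p m′ in
       [ proj₁ (f x) , [ proj₂ (f x) , dis x ]′ ]′ (Trail.on q m))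

  kite-linkage : ∀ {u₁ u₂ u₃ u₄} → Kite (Apart u₁ u₂ u₃ u₄) u₁ u₂ u₃ u₄ → KiteLinkage G u₂ u₁ u₃ u₄
  kite-linkage {u₁} {u₂} {u₃} {u₄} K =
    P p , P q , P r , P s , isPath p , isPath q , isPath r , isPath s ,
    internally-disjoint p q d₁ₘ (e13 ∘ free₁) (e21 ∘ freeₘ) ,
    internally-disjoint p r d₁₃ (e32 ∘ free₁) (e21 ∘ free₃) ,
    internally-disjoint p s d₁ₛ (e24 ∘ free₁) (e21 ∘ freeₛ) ,
    internally-disjoint q r (λ m t → d₃ₘ t m) (e32 ∘ freeₘ) (e13 ∘ free₃) ,
    internally-disjoint q s dₘₛ (e24 ∘ freeₘ) (e13 ∘ freeₛ) ,
    internally-disjoint r s d₃ₛ (e24 ∘ free₃) (e32 ∘ freeₛ)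
    where
    open Kite K
    open Trail using (P; isPath)
    p = trail link₁
    q = trail linkₘ
    r = trail (link-sym link₃)
    s = trail linkₛ
    e21 : ∀ {v} → Apart u₁ u₂ u₃ u₄ v → v ≢ u₂ × v ≢ u₁
    e21 (a , b , c , d) = b , a
    e13 : ∀ {v} → Apart u₁ u₂ u₃ u₄ v → v ≢ u₁ × v ≢ u₃
    e13 (a , b , c , d) = a , c
    e32 : ∀ {v} → Apart u₁ u₂ u₃ u₄ v → v ≢ u₃ × v ≢ u₂
    e32 (a , b , c , d) = c , b
    e24 : ∀ {v} → Apart u₁ u₂ u₃ u₄ v → v ≢ u₂ × v ≢ u₄
    e24 (a , b , c , d) = b , d

  pair-cycle : ∀ {u v X} (p : Pair u v X) → u ≢ v → (∀ {w} → X w → w ≢ u × w ≢ v) →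
    ∃[ C ] (IsCycle G C × u ∈ C × v ∈ C × (∀ {w} → w ∈ C → w ≡ u ⊎ w ≡ v ⊎ ∃[ i ] w ∈ walk p i))
  pair-cycle {u} {v} {X} p u≢v off with shorten Fₚ._≟_ (chain p false) | shorten Fₚ._≟_ (chain p true)
  ... | ys , c , uy , suby | zs , d , uz , subz =
    u ∷ ys ++ v ∷ reverse zs ,
    (u , from p true , walk-of (u~from p false ∷ append c (to~v p false) (~-sym (to~v p true) ∷ reverse-chain ~-sym d)) ,
     ~⇒Adj (~-sym (u~from p true)) , All.tabulate (λ m e → u∉ (subst (_∈ (ys ++ v ∷ reverse zs)) (sym e) m)) ∷
       Uₚ.++⁺ uy (All.tabulate (λ m e → v∉ (subst (_∈ reverse zs) (sym e) m)) ∷ reverse-unique uz) dis ,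
     -- `u`, `v` and one vertex of the first walk make three.
     s≤s (ℕₚ.≤-trans (ℕₚ.+-mono-≤ (nonempty c) (s≤s z≤n)) (ℕₚ.≤-reflexive (sym (Lₚ.length-++ ys))))) ,
    here refl , there (∈-++⁺ʳ ys (here refl)) , on
    where
    v∉ : v ∉ reverse zs
    v∉ m = proj₂ (off (inside p true (subz (∈-reverse⁻ m)))) refl
    dis : ∀ {w} → w ∈ ys × w ∈ (v ∷ reverse zs) → ⊥
    dis (m , here refl) = proj₂ (off (inside p false (suby m))) refl
    dis (m , there m′) = apart p false (suby m) (subz (∈-reverse⁻ m′))
    u∉ : u ∉ (ys ++ v ∷ reverse zs)
    u∉ m with ∈-++⁻ ys m
    ... | inj₁ q = proj₁ (off (inside p false (suby q))) refl
    ... | inj₂ (here e) = u≢v e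
    ... | inj₂ (there q) = proj₁ (off (inside p true (subz (∈-reverse⁻ q)))) refl
    on : ∀ {w} → w ∈ (u ∷ ys ++ v ∷ reverse zs) → w ≡ u ⊎ w ≡ v ⊎ ∃[ i ] w ∈ walk p i
    on (here e) = inj₁ e
    on (there m) with ∈-++⁻ ys m
    ... | inj₁ q = inj₂ (inj₂ (_ , suby q))
    ... | inj₂ (here e) = inj₂ (inj₁ e)
    ... | inj₂ (there q) = inj₂ (inj₂ (_ , subz (∈-reverse⁻ q)))

  module Blossom (σ : Setting) (ring : Ring (Setting.M σ) (Setting.u₄ σ)) (s : Linking.Spokes σ ring)
    (u₁~x : Setting.u₁ σ ~ Linking.Spokes.x s 0F) (u₃~x : Setting.u₃ σ ~ Linking.Spokes.x s 2F) where
    open Linking σ ring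
    open Spokes s
    open Moving s using (sides; sp)

    u : Fin 3 → V
    u 0F = u₁
    u 1F = u₂
    u 2F = u₃

    u~x : ∀ i → u i ~ x i
    u~x 0F = u₁~x
    u~x 1F = ~-sym (goal 1F)
    u~x 2F = u₃~x

    u-roots : ∀ i {w} → Free w → w ≢ u i
    u-roots 0F (a , b , c , d) = a
    u-roots 1F (a , b , c , d) = b
    u-roots 2F (a , b , c , d) = c

    record Stem (i : Fin 3) : Set where
      field
        Q      : List V
        isPath : IsPath G (u i) (v i) Q
        on     : ∀ {w} → w ∈ Q → w ≡ u i ⊎ w ∈ P i
        within : ∀ {w} → w ∈ inner Q → w ∈ P i × w ≢ v i

    stem : ∀ i → Stem i
    stem i with shorten Fₚ._≟_ (u~x i ∷ reverse-chain ~-sym (spoke i))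
    ... | ys , c , uq , sub = record
      { Q = ys ; isPath = walk-of c , uq ; on = on
      ; within = λ m → let p , ne , ne′ = inner-ends c uq m in [ ⊥-elim ∘ ne , id ]′ (on p) , ne′ }
      where
      on : ∀ {w} → w ∈ ys → w ≡ u i ⊎ w ∈ P i
      on m with sub m
      ... | here e = inj₁ e
      ... | there m′ = inj₂ (∈-reverse⁻ m′)

    stems-disjoint : ∀ i j → i ≢ j → u i ≢ u j → Disjoint (Stem.Q (stem i)) (Stem.Q (stem j))
    stems-disjoint i j ne ue m m′ with Stem.on (stem i) m | Stem.on (stem j) m′
    ... | inj₁ e | inj₁ e′ = ue (trans (sym e) e′)
    ... | inj₁ refl | inj₂ q = u-roots i (M-free (P⊆M j q)) refl
    ... | inj₂ p | inj₁ refl = u-roots j (M-free (P⊆M i p)) refl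
    ... | inj₂ p | inj₂ q = ne (apart-P p q)

    c₁ = pair-cycle side₁ (1≢2 ∘ sym) (λ ((a , b , c , d) , _) → b , a)
    c₂ = pair-cycle side₃ 2≢3 (λ ((a , b , c , d) , _) → b , c)
    C₁ C₂ C₃ : List V
    C₁ = proj₁ c₁
    C₂ = proj₁ c₂
    C₃ = u₄ ∷ T

    on₁ : ∀ {w} → w ∈ C₁ → w ≡ u₂ ⊎ w ≡ u₁ ⊎ ∃[ i ] w ∈ walk side₁ i
    on₁ = proj₂ (proj₂ (proj₂ (proj₂ c₁)))
    on₂ : ∀ {w} → w ∈ C₂ → w ≡ u₂ ⊎ w ≡ u₃ ⊎ ∃[ i ] w ∈ walk side₃ i
    on₂ = proj₂ (proj₂ (proj₂ (proj₂ c₂)))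

    cycle₃ : IsCycle G C₃
    cycle₃ = u₄ , t₂ , step (~⇒Adj (~-sym t₁~u₄)) (walk-of T-chain) , ~⇒Adj t₂~u₄ ,
      (All.tabulate (λ m e → proj₂ (proj₂ (proj₂ (M-free (T⊆M m)))) (sym e)) ∷ T-unique) , ℕₚ.m≤n⇒m≤1+n 3≤T

    M∉C₁ : ∀ {w} → w ∈ M → w ∉ C₁
    M∉C₁ m c with on₁ c
    ... | inj₁ refl = proj₁ (proj₂ (M-free m)) refl
    ... | inj₂ (inj₁ refl) = proj₁ (M-free m) refl
    ... | inj₂ (inj₂ (i , q)) = W-∉M (inside side₁ i q) m

    M∉C₂ : ∀ {w} → w ∈ M → w ∉ C₂
    M∉C₂ m c with on₂ c
    ... | inj₁ refl = proj₁ (proj₂ (M-free m)) refl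
    ... | inj₂ (inj₁ refl) = proj₁ (proj₂ (proj₂ (M-free m))) refl
    ... | inj₂ (inj₂ (i , q)) = W-∉M (inside side₃ i q) m

    u₄∉C₁ : u₄ ∉ C₁
    u₄∉C₁ c with on₁ c
    ... | inj₁ e = 2≢4 (sym e)
    ... | inj₂ (inj₁ e) = 1≢4 (sym e)
    ... | inj₂ (inj₂ (i , q)) = proj₂ (proj₂ (proj₂ (proj₁ (inside side₁ i q)))) refl

    u₄∉C₂ : u₄ ∉ C₂
    u₄∉C₂ c with on₂ c
    ... | inj₁ e = 2≢4 (sym e)
    ... | inj₂ (inj₁ e) = 3≢4 (sym e)
    ... | inj₂ (inj₂ (i , q)) = proj₂ (proj₂ (proj₂ (proj₁ (inside side₃ i q)))) refl

    meet : ∀ {w} → w ∈ C₁ → w ∈ C₂ → w ≡ u₂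
    meet m m′ with on₁ m | on₂ m′
    ... | inj₁ e | _ = e
    ... | inj₂ _ | inj₁ e = e
    ... | inj₂ (inj₁ refl) | inj₂ (inj₁ e) = ⊥-elim (1≢3 e)
    ... | inj₂ (inj₁ refl) | inj₂ (inj₂ (i , q)) = ⊥-elim (proj₁ (proj₁ (inside side₃ i q)) refl)
    ... | inj₂ (inj₂ (i , q)) | inj₂ (inj₁ refl) = ⊥-elim (proj₁ (proj₂ (proj₂ (proj₁ (inside side₁ i q)))) refl)
    ... | inj₂ (inj₂ (i , q)) | inj₂ (inj₂ (j , q′)) = ⊥-elim (cross i j q q′)

    stem-inner : ∀ i → Disjoint (inner (Stem.Q (stem i))) (C₁ ++ C₂ ++ C₃)
    stem-inner i m k with Stem.within (stem i) m | ∈-++⁻ C₁ k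
    ... | p , ne | inj₁ k₁ = M∉C₁ (P⊆M i p) k₁
    ... | p , ne | inj₂ k′ with ∈-++⁻ C₂ k′
    ...   | inj₁ k₂ = M∉C₂ (P⊆M i p) k₂
    ...   | inj₂ (here refl) = proj₂ (proj₂ (proj₂ (M-free (P⊆M i p)))) refl
    ...   | inj₂ (there t) = ne (only i p t)

    -- `v 1F` lies between the other two on `T`. If `v 0F` comes first, rotating `u₄` to the end
    -- gives the order; otherwise `C₃` itself reads `u₄`, `v 2F`, `v 1F`, `v 0F`, which is the order
    -- reversed.
    cyclic : CyclicOrder C₃ (v 0F) (v 1F) (v 2F) u₄
    cyclic with sides
    ... | inj₁ (p , q) = u₄ ∷ [] , T , refl , inj₁ (Subₚ.++⁺ {as = v 0F ∷ v 1F ∷ v 2F ∷ []}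
            (subst (_ ⊆_) (sym (SplitAt.split sp)) (Subₚ.++⁺ (singleton⊆ p) (refl ∷ singleton⊆ q)))
            (singleton⊆ (here refl)))
    ... | inj₂ (p , q) = [] , C₃ , refl , inj₂ (Subₚ.reverse⁺ {as = u₄ ∷ v 2F ∷ v 1F ∷ v 0F ∷ []}
            (Subₚ.++⁺ʳ [] (refl ∷
              subst (_ ⊆_) (sym (SplitAt.split sp)) (Subₚ.++⁺ (singleton⊆ q) (refl ∷ singleton⊆ p)))))

    flower : Flower G u₁ u₂ u₃ u₄
    flower = C₁ , C₂ , C₃ , Q (stem 0F) , Q (stem 1F) , Q (stem 2F) , v 0F , v 1F , v 2F ,
      proj₁ (proj₂ c₁) , proj₁ (proj₂ c₂) , cycle₃ ,
      proj₁ (proj₂ (proj₂ (proj₂ c₁))) , proj₁ (proj₂ (proj₂ (proj₂ c₂))) ,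
      proj₁ (proj₂ (proj₂ c₁)) , proj₁ (proj₂ (proj₂ c₂)) , meet ,
      (λ { (here refl) → u₄∉C₁ ; (there m) → M∉C₁ (T⊆M m) }) ,
      (λ { (here refl) → u₄∉C₂ ; (there m) → M∉C₂ (T⊆M m) }) ,
      isPath (stem 0F) , isPath (stem 1F) , isPath (stem 2F) ,
      there (v∈T 0F) , there (v∈T 1F) , there (v∈T 2F) ,
      stem-inner 0F , stem-inner 1F , stem-inner 2F ,
      stems-disjoint 0F 1F (λ ()) 1≢2 , stems-disjoint 0F 2F (λ ()) 1≢3 , stems-disjoint 1F 2F (λ ()) 2≢3 ,
      cyclic
      where open Stem

  blossom : (σ : Setting) → Flower G (Setting.u₁ σ) (Setting.u₂ σ) (Setting.u₃ σ) (Setting.u₄ σ)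
  blossom σ = let s , r₁ , r₃ = Spoking.anchored σ (Closing.ring σ) in Blossom.flower σ (Closing.ring σ) s r₁ r₃

  -- `CyclicOrder` accepts both directions of `C₃`, so exchanging `u₁` and `u₃` turns a flower into
  -- its mirror image, and it is enough to aim at one of the two.
  no-kite⇒flower : ∀ u₁ u₂ u₃ u₄ → u₁ ≢ u₂ → u₁ ≢ u₃ → u₁ ≢ u₄ → u₂ ≢ u₃ → u₂ ≢ u₄ → u₃ ≢ u₄ →
    ¬ KiteLinkage G u₂ u₁ u₃ u₄ → Flower G u₁ u₂ u₃ u₄
  no-kite⇒flower u₁ u₂ u₃ u₄ 1≢2 1≢3 1≢4 2≢3 2≢4 3≢4 noKite =
    let σ , eq = Maximal.setting u₁ u₂ u₃ u₄ 1≢2 1≢3 1≢4 2≢3 2≢4 3≢4 (noKite ∘ kite-linkage)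
    in subst (λ (a , b , c , d) → Flower G a b c d) eq (blossom σ)

theorem4p3 : ∀ {n} (G : SimpleGraph n) → KConnected G 8 →
    (u₁ u₂ u₃ u₄ : Fin n) →
    u₁ ≢ u₂ → u₁ ≢ u₃ → u₁ ≢ u₄ → u₂ ≢ u₃ → u₂ ≢ u₄ → u₃ ≢ u₄ →
    ¬ KiteLinkage G u₂ u₁ u₃ u₄ →
    Flower G u₁ u₂ u₃ u₄ ⊎ Flower G u₃ u₂ u₁ u₄
theorem4p3 G kc u₁ u₂ u₃ u₄ 1≢2 1≢3 1≢4 2≢3 2≢4 3≢4 noKite = inj₁
  (Assembly.no-kite⇒flower G _~_ _~?_ ~-sym ~-irrefl (proj₁ kc) connected ~⇒Adj
    u₁ u₂ u₃ u₄ 1≢2 1≢3 1≢4 2≢3 2≢4 3≢4 noKite)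
  where open Extraction G kc
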